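{- Let $p$ be a prime with $p\equiv 15$ or $27\pmod{28}$. For all integers $m,n,k\geq 0$ with $p\nmid n$, \[ c_{13,1}\left(2^{3k+3}p^{2m+1}n+\frac{5\cdot 2^{3k+3}p^{2m+2}+9}{7}\right)\equiv 0\pmod 2. \]
   Context: For complex $a,b$ the false theta function is $\Psi(a,b):=\sum_{n=0}^\infty a^{n(n+1)/2}b^{n(n-1)/2}-\sum_{n=-\infty}^{ -1}a^{n(n+1)/2}b^{n(n-1)/2}$. For positive integers $r,s$, the integers $c_{r,s}(n)$ ($n\ge 0$) are defined by the power series identity $\sum_{n=0}^\infty c_{r,s}(n)q^n=\dfrac{1}{\Psi(-q^r,q^s)}$ (the denominator is a power series in $q$ with constant term $1$). -}

module Defs where

open import Data.Nat as ℕ using (ℕ; zero; suc; _≡ᵇ_; _∸_)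
open import Data.Integer as ℤ using (ℤ; +_; -_; _+_; _*_)
open import Data.Bool using (if_then_else_)
open import Data.List using (List; []; _∷_; map; zipWith; upTo; head; foldr)
open import Data.Maybe using (fromMaybe)

sumℤ : List ℤ → ℤ
sumℤ = foldr _+_ (+ 0)

tri : ℕ → ℕ
tri zero = 0
tri (suc n) = suc n ℕ.+ tri n

sgn : ℕ → ℤ
sgn zero = + 1
sgn (suc e) = - sgn e

-- Coefficient of q^N in Ψ(-q^r, q^s).
-- Term with index n ≥ 0 :  (-1)^{T(n)} q^{r T(n) + s T(n-1)}
-- Term with index n = -(m+1), m ≥ 0 (subtracted):
--   -(-1)^{T(m)} q^{r T(m) + s T(m+1)}
-- (n(n+1)/2 = T(m), n(n-1)/2 = T(m+1) for n = -(m+1)).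
-- Since r,s ≥ 1, every term with index n ≥ 0 (resp. m ≥ 0) has exponent ≥ n
-- (resp. ≥ m+1), so summing indices 0..N captures all contributions to q^N.
psiCoeff : ℕ → ℕ → ℕ → ℤ
psiCoeff r s N = sumℤ (map term (upTo (suc N)))
  where
  ind : ℕ → ℕ → ℤ
  ind e x = if e ≡ᵇ x then + 1 else + 0
  term : ℕ → ℤ
  term n = sgn (tri n) * ind (r ℕ.* tri n ℕ.+ s ℕ.* tri (n ∸ 1)) N
           + - (sgn (tri n) * ind (r ℕ.* tri n ℕ.+ s ℕ.* tri (suc n)) N)

-- cList r s N = [ c(N) , c(N-1) , … , c(0) ] where Σ c(n) q^n = 1 / Ψ(-q^r,q^s),
-- computed by the recursion c(0) = 1,  c(N) = - Σ_{j=1}^{N} ψ_j c(N-j)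
-- (valid because ψ_0 = 1 for r,s ≥ 1).
cList : ℕ → ℕ → ℕ → List ℤ
cList r s zero = + 1 ∷ []
cList r s (suc N) =
  - sumℤ (zipWith _*_ (map (λ j → psiCoeff r s (suc j)) (upTo (suc N))) prev) ∷ prev
  where
  prev = cList r s N

c : ℕ → ℕ → ℕ → ℤ
c r s N = fromMaybe (+ 0) (head (cList r s N))

{-# OPTIONS --safe #-}

-- Modulo 2, Ψ(-q¹³, q) is f(q) = Σ_x q^(7x² + 6x) over x ∈ ℤ, and squaring a series over 𝔽₂
-- replaces q by q²; hence f(q⁸) · (1/f(q)) = f(q) f(q²) f(q⁴). Completing squares, the exponents
-- ≡ 7 (mod 8) of the right-hand side are counted by solutions of
-- 4X² + 2Y² + Z² = 8(7L + 14) with X, Y, Z ≡ 3 (mod 7), and a linear change of variables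
-- turns these into solutions of U² + V² + W² = 7L + 14 with U ≡ 3, V ≡ 1, W ≡ 2 (mod 7).
-- Cancelling the factor f(q) coming from U leaves
--   c(8L + 7) ≡ #{(V, W) : V ≡ 1, W ≡ 2 (mod 7), V² + W² = 7L + 5}  (mod 2).
-- For the L of the theorem, 7L + 5 = 8ᵏ p^(2m+1) (7n + 5p) contains the prime p ≡ 3 (mod 4) to an
-- odd power, so it is not a sum of two squares.
module Submission where

open import Defs
open import Data.Bool using (true; false; if_then_else_)
open import Data.Nat using (ℕ; _+_; _*_; _^_; _/_; _%_)
open import Data.Nat as ℕ using (zero; suc; _∸_; _≤_; _<_; _≡ᵇ_; z≤n; s≤s; NonZero)
import Data.Nat.Properties as ℕ
import Data.Nat.Divisibility as ℕ
import Data.Nat.DivMod as ℕ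
import Data.Nat.Tactic.RingSolver as ℕ
open import Data.Nat.Coprimality using (Coprime; coprime-Bézout)
open import Data.Nat.Divisibility using (_∣_; divides)
open import Data.Nat.GCD using (module Bézout)
open import Data.Nat.Induction using (<-rec)
open import Data.Nat.Primality using (Prime; prime⇒irreducible; prime⇒nonZero; euclidsLemma)
open import Data.Integer using (+_)
open import Data.Integer as ℤ using (ℤ; -[1+_]; ∣_∣; _⊖_)
import Data.Integer.Properties as ℤ
import Data.Integer.Tactic.RingSolver as ℤ
open import Data.Integer.Divisibility using () renaming (_∣_ to _∣ℤ_)
open import Data.Parity as ℙ using (Parity; 0ℙ; 1ℙ)
import Data.Parity.Properties as ℙ
open import Data.List
  using (List; []; _∷_; _++_; map; filter; zipWith; upTo; applyUpTo; cartesianProduct)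
import Data.List.Properties as List
open import Data.List.Membership.Propositional using (_∈_)
open import Data.List.Membership.Propositional.Properties using
  (∈-map⁺; ∈-map⁻; ∈-filter⁺; ∈-filter⁻; ∈-++⁺ˡ; ∈-++⁺ʳ; ∈-upTo⁺; ∈-upTo⁻; ∈-cartesianProduct⁺)
open import Data.List.Membership.Propositional.Properties.WithK using (unique∧set⇒bag)
open import Data.List.Relation.Binary.BagAndSetEquality using (∼bag⇒↭)
open import Data.List.Relation.Binary.Permutation.Propositional as ↭ using (_↭_)
open import Data.List.Relation.Unary.Any using (here; there)
open import Data.List.Relation.Unary.Unique.Propositional using (Unique)
import Data.List.Relation.Unary.Unique.Propositional.Properties as Unique
open import Data.Empty using (⊥; ⊥-elim)
open import Data.Product using (_×_; _,_; ∃-syntax; proj₁; proj₂)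
open import Data.Sum using (_⊎_; inj₁; inj₂)
open import Function using (_∘_; mk⇔)
open import Relation.Binary.PropositionalEquality
  using (_≡_; _≢_; refl; sym; trans; cong; cong₂; subst; module ≡-Reasoning)
open import Relation.Nullary using (¬_; yes; no; contradiction)
open import Algebra.Properties.AbelianGroup ℤ.+-0-abelianGroup using (∙-cancelʳ)
open import Algebra.Properties.CommutativeSemigroup ℙ.+-commutativeSemigroup
  using () renaming (interchange to +-interchange)

-- Sums of two squares

even⊎odd : ∀ n → (∃[ k ] n ≡ 2 * k) ⊎ (∃[ k ] n ≡ 2 * k + 1)
even⊎odd zero = inj₁ (0 , refl)
even⊎odd (suc n) with even⊎odd n
... | inj₁ (k , refl) = inj₂ (k , ℕ.+-comm 1 (2 * k))
... | inj₂ (k , refl) = inj₁ (suc k , expand k)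
  where
  expand : ∀ k → suc (2 * k + 1) ≡ 2 * suc k
  expand = ℕ.solve-∀

-- Evenness of the root puts its square plus 1 in the class 1 modulo 4, which fixes the class of the
-- cofactor in the descent below.
even-square%4 : ∀ k → (2 * k * (2 * k) + 1) % 4 ≡ 1
even-square%4 k = trans (cong (_% 4) (expand k)) (ℕ.[m+kn]%n≡m%n 1 (k * k) 4)
  where
  expand : ∀ k → 2 * k * (2 * k) + 1 ≡ 1 + k * k * 4
  expand = ℕ.solve-∀

cofactor%4 : ∀ m n → n % 4 ≡ 3 → (m * n) % 4 ≡ 1 → m % 4 ≡ 3
cofactor%4 m n n%4≡3 mn%4≡1 = residues (m % 4) (ℕ.m%n<n m 4)
  (trans (sym (trans (ℕ.%-distribˡ-* m n 4) (cong (λ r → (m % 4 * r) % 4) n%4≡3))) mn%4≡1)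
  where
  residues : ∀ r → r < 4 → (r * 3) % 4 ≡ 1 → r ≡ 3
  residues 3 _ _ = refl
  residues (suc (suc (suc (suc r)))) (s≤s (s≤s (s≤s (s≤s ())))) _

square+1<square : ∀ {t n} → 0 < t → t < n → t * t + 1 < n * n
square+1<square {t} {n} 0<t t<n = begin-strict
  t * t + 1               ≤⟨ ℕ.+-monoʳ-≤ (t * t) 0<t ⟩
  t * t + t               <⟨ ℕ.m<m+n (t * t + t) (s≤s z≤n) ⟩
  t * t + t + suc t       ≡⟨ expand t ⟩
  suc t * suc t           ≤⟨ ℕ.*-mono-≤ t<n t<n ⟩
  n * n                   ∎
  where
  open ℕ.≤-Reasoning
  expand : ∀ t → t * t + t + suc t ≡ suc t * suc t
  expand = ℕ.solve-∀

-- Modulo `n` the numbers `r` and `s` are negatives of each other, so their squares agree.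
∣square+1-complement : ∀ {n} r s → n ≡ r + s → n ∣ r * r + 1 → n ∣ s * s + 1
∣square+1-complement {n} r s refl n∣r²+1 = ℕ.∣m+n∣m⇒∣n
  (subst (n ∣_) (swap r s) (ℕ.∣m∣n⇒∣m+n n∣r²+1 (ℕ.m∣m*n s))) (ℕ.m∣m*n r)
  where
  swap : ∀ r s → r * r + 1 + (r + s) * s ≡ (r + s) * r + (s * s + 1)
  swap = ℕ.solve-∀

-- Reduce `x` to its remainder r. Both r and n - r are square roots of -1, and as `n` is odd,
-- exactly one of them is even.
even-root : ∀ {n} x .{{_ : NonZero n}} → n % 2 ≡ 1 → n ∣ x * x + 1 →
            ∃[ k ] (2 * k < n × n ∣ 2 * k * (2 * k) + 1)
even-root {n} x n-odd n∣x²+1 = choose (even⊎odd r)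
  where
  r = x % n
  q = x / n
  expand : ∀ r q n → (r + q * n) * (r + q * n) + 1 ≡ n * (2 * r * q + q * q * n) + (r * r + 1)
  expand = ℕ.solve-∀
  r≤n : r ≤ n
  r≤n = ℕ.<⇒≤ (ℕ.m%n<n x n)
  n∣r²+1 : n ∣ r * r + 1
  n∣r²+1 = ℕ.∣m+n∣m⇒∣n (subst (n ∣_)
    (trans (cong (λ y → y * y + 1) (ℕ.m≡m%n+[m/n]*n x n)) (expand r q n)) n∣x²+1) (ℕ.m∣m*n _)
  sum-of-odds : ∀ j k → 2 * j + 1 + (2 * k + 1) ≡ 0 + (suc (j + k)) * 2
  sum-of-odds = ℕ.solve-∀
  choose : (∃[ k ] r ≡ 2 * k) ⊎ (∃[ k ] r ≡ 2 * k + 1) →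
           ∃[ k ] (2 * k < n × n ∣ 2 * k * (2 * k) + 1)
  choose (inj₁ (k , r≡)) =
    k , subst (_< n) r≡ (ℕ.m%n<n x n) , subst (λ y → n ∣ y * y + 1) r≡ n∣r²+1
  choose (inj₂ (j , r≡)) with even⊎odd (n ∸ r)
  ... | inj₁ (k , n∸r≡) =
    -- The strict bound n - r < n needs r > 0, which holds because r is odd here.
    k , subst (_< n) n∸r≡ (ℕ.∸-monoʳ-< {n} (subst (0 <_) (sym r≡) (ℕ.m≤n+m 1 (2 * j))) r≤n) ,
    subst (λ y → n ∣ y * y + 1) n∸r≡
      (∣square+1-complement r (n ∸ r) (sym (ℕ.m+[n∸m]≡n r≤n)) n∣r²+1)
  ... | inj₂ (k , n∸r≡) = contradiction (trans (sym n-odd) n-even) λ ()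
    where
    n-even : n % 2 ≡ 0
    n-even = trans (cong (_% 2) (trans (sym (ℕ.m+[n∸m]≡n r≤n))
      (trans (cong₂ _+_ r≡ n∸r≡) (sum-of-odds j k)))) (ℕ.[m+kn]%n≡m%n 0 (suc (j + k)) 2)

-- Descent: for an even root t < n, the cofactor m of t² + 1 = m n is again ≡ 3 (mod 4), and m < n.
3mod4∤square+1 : ∀ n x → n % 4 ≡ 3 → ¬ n ∣ x * x + 1
3mod4∤square+1 = <-rec _ descend
  where
  descend : ∀ n → (∀ {m} → m < n → ∀ x → m % 4 ≡ 3 → ¬ m ∣ x * x + 1) →
            ∀ x → n % 4 ≡ 3 → ¬ n ∣ x * x + 1
  descend (suc n-1) rec x n%4≡3 n∣x²+1
    with even-root x (trans (sym (m%n%o≡m%o (suc n-1))) (cong (_% 2) n%4≡3)) n∣x²+1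
    where
    m%n%o≡m%o : ∀ m → m % 4 % 2 ≡ m % 2
    m%n%o≡m%o m = ℕ.m∣n⇒o%n%m≡o%m 2 4 m (divides 2 refl)
  ... | k , 2k<n , divides m eq = rec m<n (2 * k) m%4≡3 (divides n (trans eq (ℕ.*-comm m n)))
    where
    n = suc n-1
    m%4≡3 : m % 4 ≡ 3
    m%4≡3 = cofactor%4 m n n%4≡3 (trans (cong (_% 4) (sym eq)) (even-square%4 k))
    m<n : m < n
    m<n = bound k 2k<n eq
      where
      bound : ∀ k → 2 * k < n → 2 * k * (2 * k) + 1 ≡ m * n → m < n
      bound (suc k) 2k<n eq =
        ℕ.*-cancelʳ-< n m n (subst (_< n * n) eq (square+1<square (s≤s z≤n) 2k<n))
      -- For the root 0 the equation reads 1 = m n, so n = 1, which is not 3 modulo 4.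
      bound zero _ eq =
        contradiction n%4≡3 (subst (λ n → n % 4 ≢ 3) (sym (ℕ.m*n≡1⇒n≡1 m n (sym eq))) λ ())

prime∤⇒coprime : ∀ {p y} → Prime p → ¬ p ∣ y → Coprime p y
prime∤⇒coprime p-prime p∤y (d∣p , d∣y) with prime⇒irreducible p-prime d∣p
... | inj₁ d≡1 = d≡1
... | inj₂ refl = contradiction d∣y p∤y

-- Were `y` prime to `p`, dividing by it would make -1 a square modulo `p`, against
-- `3mod4∤square+1`.
prime∣sum-of-squares⇒∣ : ∀ {p} → Prime p → p % 4 ≡ 3 → ∀ x y → p ∣ x * x + y * y → p ∣ y
prime∣sum-of-squares⇒∣ {p} p-prime p%4≡3 x y p∣x²+y² with p ℕ.∣? y
... | yes p∣y = p∣y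
... | no p∤y = ⊥-elim (by-inverse (coprime-Bézout (prime∤⇒coprime p-prime p∤y)))
  where
  expand₁ : ∀ b x y → b * b * (x * x + y * y) + 2 * (1 + b * y) ≡
                      (1 + b * y) * (1 + b * y) + (b * x * (b * x) + 1)
  expand₁ = ℕ.solve-∀
  expand₂ : ∀ b x y → b * b * (x * x + y * y) ≡ b * x * (b * x) + b * y * (b * y)
  expand₂ = ℕ.solve-∀
  expand₃ : ∀ a p z → z + (1 + a * p) * (1 + a * p) ≡ (2 * a + a * p * a) * p + (z + 1)
  expand₃ = ℕ.solve-∀
  -- In both cases b²y² ≡ 1 (mod p), so b²(x² + y²) ≡ (bx)² + 1.
  by-inverse : Bézout.Identity 1 p y → ⊥
  by-inverse (Bézout.+- a b eq) = 3mod4∤square+1 p (b * x) p%4≡3 (ℕ.∣m+n∣m⇒∣n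
    (subst (p ∣_) (expand₁ b x y) (ℕ.∣m∣n⇒∣m+n (ℕ.∣n⇒∣m*n (b * b) p∣x²+y²) (ℕ.∣n⇒∣m*n 2 p∣1+by)))
    (ℕ.∣n⇒∣m*n (1 + b * y) p∣1+by))
    where
    p∣1+by : p ∣ 1 + b * y
    p∣1+by = divides a eq
  by-inverse (Bézout.-+ a b eq) = 3mod4∤square+1 p (b * x) p%4≡3 (ℕ.∣m+n∣m⇒∣n
    (subst (p ∣_) (trans (expand₂ b x y) (trans
      (cong (λ z → b * x * (b * x) + z * z) (sym eq)) (expand₃ a p (b * x * (b * x)))))
      (ℕ.∣n⇒∣m*n (b * b) p∣x²+y²)) (ℕ.n∣m*n (2 * a + a * p * a)))

-- Both `x` and `y` are multiples of `p`, so p² cancels and the exponent drops by 2. At exponent 1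
-- one factor p is left over on the side of the squares and must divide `t`.
sum-of-squares-odd-power : ∀ {p} → Prime p → p % 4 ≡ 3 → ∀ m t x y →
                           x * x + y * y ≡ p ^ (2 * m + 1) * t → p ∣ t
sum-of-squares-odd-power {p} p-prime p%4≡3 m t x y eq = reduce m eq p∣x p∣y
  where
  instance _ = prime⇒nonZero p-prime
  p^odd : ∀ m → p ^ (2 * m + 1) ≡ p * p ^ (2 * m)
  p^odd m = cong (p ^_) (ℕ.+-comm (2 * m) 1)
  p∣sum : p ∣ x * x + y * y
  p∣sum = subst (p ∣_) (sym eq) (ℕ.∣m⇒∣m*n t (subst (p ∣_) (sym (p^odd m)) (ℕ.m∣m*n _)))
  p∣y = prime∣sum-of-squares⇒∣ p-prime p%4≡3 x y p∣sum
  p∣x = prime∣sum-of-squares⇒∣ p-prime p%4≡3 y x (subst (p ∣_) (ℕ.+-comm (x * x) (y * y)) p∣sum)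
  p²-factor : ∀ a b p → a * p * (a * p) + b * p * (b * p) ≡ p * (p * (a * a + b * b))
  p²-factor = ℕ.solve-∀
  reduce : ∀ m → x * x + y * y ≡ p ^ (2 * m + 1) * t → p ∣ x → p ∣ y → p ∣ t
  reduce zero eq (divides a refl) (divides b refl) =
    divides (a * a + b * b) (trans (sym (ℕ.*-cancelˡ-≡ _ _ p (trans (sym (p²-factor a b p))
      (trans eq (cong (_* t) (ℕ.*-identityʳ p)))))) (ℕ.*-comm p _))
  reduce (suc m) eq (divides a refl) (divides b refl) =
    sum-of-squares-odd-power p-prime p%4≡3 m t a b (ℕ.*-cancelˡ-≡ _ _ p (ℕ.*-cancelˡ-≡ _ _ p
      (trans (sym (p²-factor a b p)) (trans eq
        (trans (cong (_* t) (power-step m)) (assoc p (p ^ (2 * m + 1)) t))))))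
    where
    power-step : ∀ m → p ^ (2 * suc m + 1) ≡ p * (p * p ^ (2 * m + 1))
    power-step m = cong (λ e → p ^ (e + 1)) (ℕ.*-suc 2 m)
    assoc : ∀ p u t → p * (p * u) * t ≡ p * (p * (u * t))
    assoc = ℕ.solve-∀

open ≡-Reasoning

-- Finite sums modulo 2

private variable I J : Set

∑ : List I → (I → Parity) → Parity
∑ []       f = 0ℙ
∑ (a ∷ as) f = f a ℙ.+ ∑ as f

∑-cong-∈ : ∀ (as : List I) {f g} → (∀ {a} → a ∈ as → f a ≡ g a) → ∑ as f ≡ ∑ as g
∑-cong-∈ []       f≗g = refl
∑-cong-∈ (a ∷ as) f≗g = cong₂ ℙ._+_ (f≗g (here refl)) (∑-cong-∈ as (f≗g ∘ there))

∑-cong : ∀ (as : List I) {f g} → (∀ a → f a ≡ g a) → ∑ as f ≡ ∑ as g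
∑-cong as f≗g = ∑-cong-∈ as (λ {a} _ → f≗g a)

∑-zero : ∀ (as : List I) → ∑ as (λ _ → 0ℙ) ≡ 0ℙ
∑-zero []       = refl
∑-zero (a ∷ as) = ∑-zero as

∑-+ : ∀ (as : List I) f g → ∑ as (λ a → f a ℙ.+ g a) ≡ ∑ as f ℙ.+ ∑ as g
∑-+ []       f g = refl
∑-+ (a ∷ as) f g =
  trans (cong ((f a ℙ.+ g a) ℙ.+_) (∑-+ as f g)) (+-interchange (f a) (g a) (∑ as f) (∑ as g))

∑-*ʳ : ∀ (as : List I) f q → ∑ as (λ a → f a ℙ.* q) ≡ ∑ as f ℙ.* q
∑-*ʳ []       f q = refl
∑-*ʳ (a ∷ as) f q =
  trans (cong (f a ℙ.* q ℙ.+_) (∑-*ʳ as f q)) (sym (ℙ.*-distribʳ-+ q (f a) (∑ as f)))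

∑-comm : ∀ (as : List I) (bs : List J) (f : I → J → Parity) →
         ∑ as (λ a → ∑ bs (λ b → f a b)) ≡ ∑ bs (λ b → ∑ as (λ a → f a b))
∑-comm []       bs f = sym (∑-zero bs)
∑-comm (a ∷ as) bs f =
  trans (cong (∑ bs (f a) ℙ.+_) (∑-comm as bs f)) (sym (∑-+ bs (f a) (λ b → ∑ as (λ a → f a b))))

-- The off-diagonal terms cancel in pairs modulo 2.
∑-diagonal : ∀ (as : List I) (f : I → I → Parity) → (∀ a b → f a b ≡ f b a) →
             ∑ as (λ a → ∑ as (f a)) ≡ ∑ as (λ a → f a a)
∑-diagonal []       f f-sym = refl
∑-diagonal (a ∷ as) f f-sym = begin
  f a a ℙ.+ r ℙ.+ ∑ as (λ b → f b a ℙ.+ ∑ as (f b))   ≡⟨ cong (f a a ℙ.+ r ℙ.+_) (∑-+ as _ _) ⟩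
  f a a ℙ.+ r ℙ.+ (∑ as (λ b → f b a) ℙ.+ d)
    ≡⟨ cong (λ s → f a a ℙ.+ r ℙ.+ (s ℙ.+ d)) (∑-cong as (λ b → f-sym b a)) ⟩
  f a a ℙ.+ r ℙ.+ (r ℙ.+ d)                           ≡⟨ ℙ.+-assoc (f a a) r (r ℙ.+ d) ⟩
  f a a ℙ.+ (r ℙ.+ (r ℙ.+ d))                         ≡⟨ cong (f a a ℙ.+_) (ℙ.+-assoc r r d) ⟨
  f a a ℙ.+ (r ℙ.+ r ℙ.+ d)
    ≡⟨ cong (λ s → f a a ℙ.+ (s ℙ.+ d)) (ℙ.p+p≡0ℙ r) ⟩
  f a a ℙ.+ d                                         ≡⟨ cong (f a a ℙ.+_) (∑-diagonal as f f-sym) ⟩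
  f a a ℙ.+ ∑ as (λ b → f b b)                        ∎
  where
  r = ∑ as (f a)
  d = ∑ as (λ b → ∑ as (f b))

∑-map : ∀ (h : I → J) as f → ∑ (map h as) f ≡ ∑ as (f ∘ h)
∑-map h []       f = refl
∑-map h (a ∷ as) f = cong (f (h a) ℙ.+_) (∑-map h as f)

∑-++ : ∀ (as bs : List I) f → ∑ (as ++ bs) f ≡ ∑ as f ℙ.+ ∑ bs f
∑-++ []       bs f = refl
∑-++ (a ∷ as) bs f = trans (cong (f a ℙ.+_) (∑-++ as bs f)) (sym (ℙ.+-assoc (f a) _ _))

∑-cartesianProduct : ∀ (as : List I) (bs : List J) f →
                     ∑ (cartesianProduct as bs) f ≡ ∑ as (λ a → ∑ bs (λ b → f (a , b)))
∑-cartesianProduct []       bs f = refl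
∑-cartesianProduct (a ∷ as) bs f = trans (∑-++ (map (a ,_) bs) _ f)
  (cong₂ ℙ._+_ (∑-map (a ,_) bs f) (∑-cartesianProduct as bs f))

∑-↭ : ∀ {as bs : List I} f → as ↭ bs → ∑ as f ≡ ∑ bs f
∑-↭ f ↭.refl                   = refl
∑-↭ f (↭.prep a p)             = cong (f a ℙ.+_) (∑-↭ f p)
∑-↭ f (↭.swap {as} {bs} a b p) = begin
  f a ℙ.+ (f b ℙ.+ ∑ as f)  ≡⟨ ℙ.+-assoc (f a) (f b) _ ⟨
  f a ℙ.+ f b ℙ.+ ∑ as f    ≡⟨ cong₂ ℙ._+_ (ℙ.+-comm (f a) (f b)) (∑-↭ f p) ⟩
  f b ℙ.+ f a ℙ.+ ∑ bs f    ≡⟨ ℙ.+-assoc (f b) (f a) _ ⟩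
  f b ℙ.+ (f a ℙ.+ ∑ bs f)  ∎
∑-↭ f (↭.trans p q)            = trans (∑-↭ f p) (∑-↭ f q)

∑-support : ∀ (as : List I) f → ∑ (filter (λ a → f a ℙ.≟ 1ℙ) as) f ≡ ∑ as f
∑-support []       f = refl
∑-support (a ∷ as) f with f a in fa≡
... | 1ℙ = cong₂ ℙ._+_ fa≡ (∑-support as f)
... | 0ℙ = ∑-support as f

-- Over 𝔽₂ a sum sees only its support. The supports, listed without repetition and matched by `h`,
-- are permutations of each other; `h` need not carry one whole list to the other.
∑-reindex : ∀ {as : List I} {bs : List J} (h : J → I) (f : I → Parity) (g : J → Parity) →
            Unique as → Unique bs → (∀ {b b′} → h b ≡ h b′ → b ≡ b′) → (∀ b → f (h b) ≡ g b) →
            (∀ {a} → a ∈ as → f a ≡ 1ℙ → ∃[ b ] b ∈ bs × a ≡ h b) →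
            (∀ {b} → b ∈ bs → g b ≡ 1ℙ → h b ∈ as) →
            ∑ as f ≡ ∑ bs g
∑-reindex {as = as} {bs} h f g as! bs! h-inj f∘h≗g onto into = begin
  ∑ as f                   ≡⟨ ∑-support as f ⟨
  ∑ (filter f? as) f       ≡⟨ ∑-↭ f (∼bag⇒↭ (unique∧set⇒bag (Unique.filter⁺ f? as!)
                                (Unique.map⁺ h-inj (Unique.filter⁺ g? bs!)) (mk⇔ to from))) ⟩
  ∑ (map h (filter g? bs)) f
                           ≡⟨ ∑-map h (filter g? bs) f ⟩
  ∑ (filter g? bs) (f ∘ h) ≡⟨ ∑-cong (filter g? bs) f∘h≗g ⟩
  ∑ (filter g? bs) g       ≡⟨ ∑-support bs g ⟩
  ∑ bs g                   ∎
  where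
  f? = λ a → f a ℙ.≟ 1ℙ
  g? = λ b → g b ℙ.≟ 1ℙ
  to : ∀ {a} → a ∈ filter f? as → a ∈ map h (filter g? bs)
  to a∈ with ∈-filter⁻ f? {xs = as} a∈
  ... | a∈as , fa≡1 with onto a∈as fa≡1
  ... | b , b∈bs , refl = ∈-map⁺ h (∈-filter⁺ g? b∈bs (trans (sym (f∘h≗g b)) fa≡1))
  from : ∀ {a} → a ∈ map h (filter g? bs) → a ∈ filter f? as
  from a∈ with ∈-map⁻ h a∈
  ... | b , b∈ , refl with ∈-filter⁻ g? {xs = bs} b∈
  ... | b∈bs , gb≡1 = ∈-filter⁺ f? (into b∈bs gb≡1) (trans (f∘h≗g b) gb≡1)

∑-upTo-suc : ∀ n f → ∑ (upTo (suc n)) f ≡ f 0 ℙ.+ ∑ (upTo n) (f ∘ suc)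
∑-upTo-suc n f = cong (f 0 ℙ.+_)
  (trans (cong (λ l → ∑ l f) (sym (List.map-upTo suc n))) (∑-map suc (upTo n) f))

∑-upTo-extend : ∀ m d f → (∀ {n} → m ≤ n → f n ≡ 0ℙ) → ∑ (upTo (m + d)) f ≡ ∑ (upTo m) f
∑-upTo-extend zero    d f f≡0 = trans (∑-cong (upTo d) (λ _ → f≡0 z≤n)) (∑-zero (upTo d))
∑-upTo-extend (suc m) d f f≡0 = begin
  ∑ (upTo (suc m + d)) f              ≡⟨ ∑-upTo-suc (m + d) f ⟩
  f 0 ℙ.+ ∑ (upTo (m + d)) (f ∘ suc)  ≡⟨ cong (f 0 ℙ.+_) (∑-upTo-extend m d (f ∘ suc) (f≡0 ∘ s≤s)) ⟩
  f 0 ℙ.+ ∑ (upTo m) (f ∘ suc)        ≡⟨ ∑-upTo-suc m f ⟨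
  ∑ (upTo (suc m)) f                  ∎

-- The theta series and its inverse modulo 2

parityℤ : ℤ → Parity
parityℤ i = ℕ.parity ∣ i ∣

parityℤ-⊖ : ∀ m n → parityℤ (m ⊖ n) ≡ ℕ.parity m ℙ.+ ℕ.parity n
parityℤ-⊖ m       zero    = sym (ℙ.+-identityʳ (ℕ.parity m))
parityℤ-⊖ zero    (suc n) = refl
parityℤ-⊖ (suc m) (suc n) = begin
  parityℤ (suc m ⊖ suc n)                 ≡⟨ cong parityℤ (ℤ.[1+m]⊖[1+n]≡m⊖n m n) ⟩
  parityℤ (m ⊖ n)                         ≡⟨ parityℤ-⊖ m n ⟩
  ℕ.parity m ℙ.+ ℕ.parity n               ≡⟨ cong₂ ℙ._+_ (ℙ.suc-homo-⁻¹ m) (ℙ.suc-homo-⁻¹ n) ⟨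
  ℕ.parity (suc m) ℙ.⁻¹ ℙ.+ ℕ.parity (suc n) ℙ.⁻¹
    ≡⟨ ⁻¹-cancel (ℕ.parity (suc m)) (ℕ.parity (suc n)) ⟩
  ℕ.parity (suc m) ℙ.+ ℕ.parity (suc n)   ∎
  where
  ⁻¹-cancel : ∀ p q → p ℙ.⁻¹ ℙ.+ q ℙ.⁻¹ ≡ p ℙ.+ q
  ⁻¹-cancel 0ℙ q = ℙ.⁻¹-involutive q
  ⁻¹-cancel 1ℙ q = refl

parityℤ-+ : ∀ i j → parityℤ (i ℤ.+ j) ≡ parityℤ i ℙ.+ parityℤ j
parityℤ-+ (+ m)    (+ n)    = ℙ.+-homo-+ m n
parityℤ-+ (+ m)    -[1+ n ] = parityℤ-⊖ m (suc n)
parityℤ-+ -[1+ m ] (+ n)    = trans (parityℤ-⊖ n (suc m)) (ℙ.+-comm (ℕ.parity n) _)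
parityℤ-+ -[1+ m ] -[1+ n ] =
  trans (cong (ℕ.parity ∘ suc) (sym (ℕ.+-suc m n))) (ℙ.+-homo-+ (suc m) (suc n))

parityℤ-* : ∀ i j → parityℤ (i ℤ.* j) ≡ parityℤ i ℙ.* parityℤ j
parityℤ-* i j = trans (cong ℕ.parity (ℤ.abs-* i j)) (ℙ.*-homo-* ∣ i ∣ ∣ j ∣)

parityℤ-neg : ∀ i → parityℤ (ℤ.- i) ≡ parityℤ i
parityℤ-neg i = cong ℕ.parity (ℤ.∣-i∣≡∣i∣ i)

parityℤ-sumℤ-map : ∀ {A : Set} (f : A → ℤ) as → parityℤ (sumℤ (map f as)) ≡ ∑ as (parityℤ ∘ f)
parityℤ-sumℤ-map f []       = refl
parityℤ-sumℤ-map f (a ∷ as) =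
  trans (parityℤ-+ (f a) (sumℤ (map f as))) (cong (parityℤ (f a) ℙ.+_) (parityℤ-sumℤ-map f as))

2i+1≢0 : ∀ i → + 2 ℤ.* i ℤ.+ + 1 ≢ + 0
2i+1≢0 i eq = contradiction (trans (sym odd) (cong parityℤ eq)) λ ()
  where
  odd : parityℤ (+ 2 ℤ.* i ℤ.+ + 1) ≡ 1ℙ
  odd = trans (parityℤ-+ (+ 2 ℤ.* i) (+ 1)) (cong (ℙ._+ 1ℙ) (parityℤ-* (+ 2) i))

-- (a , b) = (6 , 1), (2 , 5), (4 , 3) give the exponents ((7x + c)² - c²) / 7 for c = 3, 1, 2.
expo : ℕ → ℕ → ℤ → ℕ
expo a b (+ n)    = n * ((a + b) * n + a)
expo a b -[1+ n ] = suc n * ((a + b) * n + b)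

-- For x = -(n + 1) both factors change sign, and (a + b)(n + 1) - a = (a + b)n + b explains the `b`
-- in the negative branch of `expo`.
expo≡poly : ∀ a b x → + expo a b x ≡ x ℤ.* (+ (a + b) ℤ.* x ℤ.+ + a)
expo≡poly a b (+ n) = trans (ℤ.pos-* n _)
  (cong (λ y → + n ℤ.* (y ℤ.+ + a)) (ℤ.pos-* (a + b) n))
expo≡poly a b -[1+ n ] = trans (ℤ.pos-* (suc n) _) (trans
  (cong (λ y → + suc n ℤ.* (y ℤ.+ + b)) (ℤ.pos-* (a + b) n)) (reflect (+ n) (+ a) (+ b)))
  where
  reflect : ∀ N A B → (+ 1 ℤ.+ N) ℤ.* ((A ℤ.+ B) ℤ.* N ℤ.+ B) ≡
                      ℤ.- (+ 1 ℤ.+ N) ℤ.* ((A ℤ.+ B) ℤ.* ℤ.- (+ 1 ℤ.+ N) ℤ.+ A)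
  reflect = ℤ.solve-∀

+-nonZeroʳ : ∀ m n .{{_ : NonZero n}} → NonZero (m + n)
+-nonZeroʳ m n = ℕ.>-nonZero (ℕ.≤-trans (ℕ.>-nonZero⁻¹ n) (ℕ.m≤n+m n m))

-- This makes truncation exact: every `x` with exponent at most B lies in `box B`.
∣x∣≤expo : ∀ a b .{{_ : NonZero a}} .{{_ : NonZero b}} x → ∣ x ∣ ≤ expo a b x
∣x∣≤expo a b (+ n)    = ℕ.m≤m*n n _ {{+-nonZeroʳ ((a + b) * n) a}}
∣x∣≤expo a b -[1+ n ] = ℕ.m≤m*n (suc n) _ {{+-nonZeroʳ ((a + b) * n) b}}

-- The interval from -(B + 1) to B. Its halves have equal length, so n pairs with -(n + 1) as in
-- `psiCoeff`, and 0 comes first.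
box : ℕ → List ℤ
box B = map +_ (upTo (suc B)) ++ map -[1+_] (upTo (suc B))

box-unique : ∀ B → Unique (box B)
box-unique B = Unique.++⁺ (Unique.map⁺ ℤ.+-injective (Unique.upTo⁺ (suc B)))
  (Unique.map⁺ ℤ.-[1+-injective (Unique.upTo⁺ (suc B))) disjoint
  where
  disjoint : ∀ {x} → x ∈ map +_ (upTo (suc B)) × x ∈ map -[1+_] (upTo (suc B)) → _
  disjoint (x∈₁ , x∈₂) with ∈-map⁻ +_ x∈₁ | ∈-map⁻ -[1+_] x∈₂
  ... | _ , _ , refl | _ , _ , ()

∈-box : ∀ {B} x → ∣ x ∣ ≤ B → x ∈ box B
∈-box     (+ n)    n≤B = ∈-++⁺ˡ (∈-map⁺ +_ (∈-upTo⁺ (s≤s n≤B)))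
∈-box {B} -[1+ n ] n<B =
  ∈-++⁺ʳ (map +_ (upTo (suc B))) (∈-map⁺ -[1+_] (∈-upTo⁺ (ℕ.m≤n⇒m≤1+n n<B)))

∑-box : ∀ B f → ∑ (box B) f ≡ ∑ (upTo (suc B)) (λ n → f (+ n) ℙ.+ f -[1+ n ])
∑-box B f = begin
  ∑ (box B) f ≡⟨ ∑-++ (map +_ (upTo (suc B))) _ f ⟩
  ∑ (map +_ (upTo (suc B))) f ℙ.+ ∑ (map -[1+_] (upTo (suc B))) f
    ≡⟨ cong₂ ℙ._+_ (∑-map +_ (upTo (suc B)) f) (∑-map -[1+_] (upTo (suc B)) f) ⟩
  ∑ (upTo (suc B)) (f ∘ +_) ℙ.+ ∑ (upTo (suc B)) (f ∘ -[1+_])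
    ≡⟨ ∑-+ (upTo (suc B)) (f ∘ +_) (f ∘ -[1+_]) ⟨
  ∑ (upTo (suc B)) (λ n → f (+ n) ℙ.+ f -[1+ n ]) ∎

-- As a sequence of coefficients this is the series 1.
δ : ℤ → Parity
δ (+ zero)  = 1ℙ
δ (+ suc _) = 0ℙ
δ -[1+ _ ]  = 0ℙ

δ≡1⇒≡0 : ∀ i → δ i ≡ 1ℙ → i ≡ + 0
δ≡1⇒≡0 (+ zero) _ = refl

δ-8* : ∀ i → δ (+ 8 ℤ.* i) ≡ δ i
δ-8* (+ zero)  = refl
δ-8* (+ suc _) = refl
δ-8* -[1+ _ ]  = refl

[_≐_] : ℕ → ℕ → Parity
[ m ≐ n ] = if m ≡ᵇ n then 1ℙ else 0ℙ

<⇒[≐]≡0 : ∀ {m n} → n < m → [ m ≐ n ] ≡ 0ℙ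
<⇒[≐]≡0 {suc m} {zero}  _         = refl
<⇒[≐]≡0 {suc m} {suc n} (s≤s n<m) = <⇒[≐]≡0 n<m

extendByZero : (ℕ → Parity) → ℤ → Parity
extendByZero h (+ n)    = h n
extendByZero h -[1+ n ] = 0ℙ

-- Multiplying by the monomial q^e shifts coefficients by `e`; if `e` exceeds `N`, the new index is
-- negative and both sides vanish.
∑-shift : ∀ h e N → ∑ (upTo (suc N)) (λ j → [ e ≐ j ] ℙ.* h (N ∸ j)) ≡ extendByZero h (N ⊖ e)
∑-shift h zero    N       = begin
  ∑ (upTo (suc N)) (λ j → [ 0 ≐ j ] ℙ.* h (N ∸ j)) ≡⟨ ∑-upTo-suc N (λ j → [ 0 ≐ j ] ℙ.* h (N ∸ j)) ⟩
  h N ℙ.+ ∑ (upTo N) (λ _ → 0ℙ)                     ≡⟨ cong (h N ℙ.+_) (∑-zero (upTo N)) ⟩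
  h N ℙ.+ 0ℙ                                        ≡⟨ ℙ.+-identityʳ (h N) ⟩
  h N ∎
∑-shift h (suc e) zero    = refl
∑-shift h (suc e) (suc N) = begin
  ∑ (upTo (suc (suc N))) (λ j → [ suc e ≐ j ] ℙ.* h (suc N ∸ j))
    ≡⟨ ∑-upTo-suc (suc N) (λ j → [ suc e ≐ j ] ℙ.* h (suc N ∸ j)) ⟩
  ∑ (upTo (suc N)) (λ j → [ e ≐ j ] ℙ.* h (N ∸ j)) ≡⟨ ∑-shift h e N ⟩
  extendByZero h (N ⊖ e) ≡⟨ cong (extendByZero h) (ℤ.[1+m]⊖[1+n]≡m⊖n N e) ⟨
  extendByZero h (suc N ⊖ suc e) ∎

-- This turns the stored history into a function of the index, so that the recursion for `c` becomes
-- a convolution.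
cList≡applyUpTo : ∀ r s N → cList r s N ≡ applyUpTo (λ j → c r s (N ∸ j)) (suc N)
cList≡applyUpTo r s zero    = refl
cList≡applyUpTo r s (suc N) = cong (c r s (suc N) ∷_) (cList≡applyUpTo r s N)

zipWith-applyUpTo : ∀ {A B C : Set} (_∙_ : A → B → C) f g n →
                    zipWith _∙_ (applyUpTo f n) (applyUpTo g n) ≡ applyUpTo (λ j → f j ∙ g j) n
zipWith-applyUpTo _∙_ f g zero    = refl
zipWith-applyUpTo _∙_ f g (suc n) =
  cong (f 0 ∙ g 0 ∷_) (zipWith-applyUpTo _∙_ (f ∘ suc) (g ∘ suc) n)

c₂ ψ₂ : ℕ → Parity
c₂ N = parityℤ (c 13 1 N)
ψ₂ N = parityℤ (psiCoeff 13 1 N)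

c₂-suc : ∀ N → c₂ (suc N) ≡ ∑ (upTo (suc N)) (λ j → ψ₂ (suc j) ℙ.* c₂ (N ∸ j))
c₂-suc N = begin
  c₂ (suc N) ≡⟨ parityℤ-neg (sumℤ (zipWith ℤ._*_ (map ψ′ (upTo (suc N))) (cList 13 1 N))) ⟩
  parityℤ (sumℤ (zipWith ℤ._*_ (map ψ′ (upTo (suc N))) (cList 13 1 N)))
    ≡⟨ cong₂ (λ ps cs → parityℤ (sumℤ (zipWith ℤ._*_ ps cs)))
         (List.map-upTo ψ′ (suc N)) (cList≡applyUpTo 13 1 N) ⟩
  parityℤ (sumℤ (zipWith ℤ._*_ (applyUpTo ψ′ (suc N)) (applyUpTo c′ (suc N))))
    ≡⟨ cong (parityℤ ∘ sumℤ) (zipWith-applyUpTo ℤ._*_ ψ′ c′ (suc N)) ⟩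
  parityℤ (sumℤ (applyUpTo ψ′c′ (suc N))) ≡⟨ cong (parityℤ ∘ sumℤ) (List.map-upTo ψ′c′ (suc N)) ⟨
  parityℤ (sumℤ (map ψ′c′ (upTo (suc N)))) ≡⟨ parityℤ-sumℤ-map ψ′c′ (upTo (suc N)) ⟩
  ∑ (upTo (suc N)) (λ j → parityℤ (ψ′ j ℤ.* c′ j))
    ≡⟨ ∑-cong (upTo (suc N)) (λ j → parityℤ-* (ψ′ j) (c′ j)) ⟩
  ∑ (upTo (suc N)) (λ j → ψ₂ (suc j) ℙ.* c₂ (N ∸ j)) ∎
  where
  ψ′ c′ : ℕ → ℤ
  ψ′ j = psiCoeff 13 1 (suc j)
  c′ j = c 13 1 (N ∸ j)
  ψ′c′ : ℕ → ℤ
  ψ′c′ j = ψ′ j ℤ.* c′ j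

-- The product of the theta series and its inverse is 1: at a positive index the term j = 0 is
-- `c₂ (suc N)`, and the recursion says that the other terms add up to the same value.
ψ₂-convolution-c₂ : ∀ N → ∑ (upTo (suc N)) (λ j → ψ₂ j ℙ.* c₂ (N ∸ j)) ≡ δ (+ N)
ψ₂-convolution-c₂ zero    = refl
ψ₂-convolution-c₂ (suc N) = begin
  ∑ (upTo (suc (suc N))) (λ j → ψ₂ j ℙ.* c₂ (suc N ∸ j))
    ≡⟨ ∑-upTo-suc (suc N) (λ j → ψ₂ j ℙ.* c₂ (suc N ∸ j)) ⟩
  c₂ (suc N) ℙ.+ ∑ (upTo (suc N)) (λ j → ψ₂ (suc j) ℙ.* c₂ (N ∸ j))
    ≡⟨ cong (c₂ (suc N) ℙ.+_) (c₂-suc N) ⟨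
  c₂ (suc N) ℙ.+ c₂ (suc N) ≡⟨ ℙ.p+p≡0ℙ (c₂ (suc N)) ⟩
  0ℙ ∎

parityℤ-sgn : ∀ e → parityℤ (sgn e) ≡ 1ℙ
parityℤ-sgn zero    = refl
parityℤ-sgn (suc e) = trans (parityℤ-neg (sgn e)) (parityℤ-sgn e)

signedIndicator : ℕ → ℕ → ℕ → ℤ
signedIndicator t m n = sgn t ℤ.* (if m ≡ᵇ n then + 1 else + 0)

parityℤ-signedIndicator : ∀ t m n → parityℤ (signedIndicator t m n) ≡ [ m ≐ n ]
parityℤ-signedIndicator t m n =
  trans (parityℤ-* (sgn t) _) (trans (cong (ℙ._* _) (parityℤ-sgn t)) (indicator (m ≡ᵇ n)))
  where
  indicator : ∀ b → parityℤ (if b then + 1 else + 0) ≡ (if b then 1ℙ else 0ℙ)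
  indicator true  = refl
  indicator false = refl

tri+tri : ∀ n → tri n + tri n ≡ n * suc n
tri+tri zero    = refl
tri+tri (suc n) =
  trans (regroup n (tri n)) (trans (cong (λ t → 2 * suc n + t) (tri+tri n)) (expand n))
  where
  regroup : ∀ n t → suc n + t + (suc n + t) ≡ 2 * suc n + (t + t)
  regroup = ℕ.solve-∀
  expand : ∀ n → 2 * suc n + n * suc n ≡ suc n * suc (suc n)
  expand = ℕ.solve-∀

expo-pos : ∀ n → 13 * tri n + 1 * tri (n ∸ 1) ≡ expo 6 1 (+ n)
-- Truncated subtraction is harmless at 0, since T(-1) = 0 = T(0).
expo-pos zero    = refl
expo-pos (suc n) = trans (regroup n (tri n))
  (trans (cong (λ t → 7 * t + 13 * suc n) (tri+tri n)) (expand n))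
  where
  regroup : ∀ n t → 13 * (suc n + t) + 1 * t ≡ 7 * (t + t) + 13 * suc n
  regroup = ℕ.solve-∀
  expand : ∀ n → 7 * (n * suc n) + 13 * suc n ≡ suc n * (7 * suc n + 6)
  expand = ℕ.solve-∀

expo-neg : ∀ n → 13 * tri n + 1 * tri (suc n) ≡ expo 6 1 -[1+ n ]
expo-neg n = trans (regroup n (tri n)) (trans (cong (λ t → 7 * t + suc n) (tri+tri n)) (expand n))
  where
  regroup : ∀ n t → 13 * t + 1 * (suc n + t) ≡ 7 * (t + t) + suc n
  regroup = ℕ.solve-∀
  expand : ∀ n → 7 * (n * suc n) + suc n ≡ suc n * (7 * n + 1)
  expand = ℕ.solve-∀

-- Signs disappear modulo 2, and the two families of terms merge into one family over ℤ. Enlarging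
-- the range from `j` to `B` only adds exponents greater than `j`.
ψ₂≡∑box : ∀ {B j} → j ≤ B → ψ₂ j ≡ ∑ (box B) (λ x → [ expo 6 1 x ≐ j ])
ψ₂≡∑box {B} {j} j≤B = begin
  parityℤ (sumℤ (map term (upTo (suc j))))  ≡⟨ parityℤ-sumℤ-map term (upTo (suc j)) ⟩
  ∑ (upTo (suc j)) (parityℤ ∘ term)         ≡⟨ ∑-cong (upTo (suc j)) parityℤ-term ⟩
  ∑ (upTo (suc j)) pair                     ≡⟨ ∑-upTo-extend (suc j) (B ∸ j) pair pair≡0 ⟨
  ∑ (upTo (suc (j + (B ∸ j)))) pair         ≡⟨ cong (λ n → ∑ (upTo (suc n)) pair) (ℕ.m+[n∸m]≡n j≤B) ⟩
  ∑ (upTo (suc B)) pair                     ≡⟨ ∑-box B (λ x → [ expo 6 1 x ≐ j ]) ⟨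
  ∑ (box B) (λ x → [ expo 6 1 x ≐ j ])      ∎
  where
  expo₊ expo₋ : ℕ → ℕ
  expo₊ n = 13 * tri n + 1 * tri (n ∸ 1)
  expo₋ n = 13 * tri n + 1 * tri (suc n)
  term₊ term₋ term : ℕ → ℤ
  term₊ n = signedIndicator (tri n) (expo₊ n) j
  term₋ n = signedIndicator (tri n) (expo₋ n) j
  term n = term₊ n ℤ.+ ℤ.- term₋ n
  pair : ℕ → Parity
  pair n = [ expo 6 1 (+ n) ≐ j ] ℙ.+ [ expo 6 1 -[1+ n ] ≐ j ]
  pair≡0 : ∀ {n} → suc j ≤ n → pair n ≡ 0ℙ
  pair≡0 {n} j<n = cong₂ ℙ._+_ (<⇒[≐]≡0 (ℕ.≤-trans j<n (∣x∣≤expo 6 1 (+ n))))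
    (<⇒[≐]≡0 (ℕ.≤-trans (ℕ.m≤n⇒m≤1+n j<n) (∣x∣≤expo 6 1 -[1+ n ])))
  parityℤ-term : ∀ n → parityℤ (term n) ≡ pair n
  parityℤ-term n = trans (parityℤ-+ (term₊ n) (ℤ.- term₋ n)) (cong₂ ℙ._+_
    (trans (parityℤ-signedIndicator (tri n) (expo₊ n) j) (cong ([_≐ j ]) (expo-pos n)))
    (trans (parityℤ-neg (term₋ n))
      (trans (parityℤ-signedIndicator (tri n) (expo₋ n) j) (cong ([_≐ j ]) (expo-neg n)))))

-- Multiplication of a series, given by its coefficients, by the truncated theta series f(qᵏ).
Θ : ℕ → ℕ → (ℤ → Parity) → ℤ → Parity
Θ B k g i = ∑ (box B) (λ x → g (i ℤ.- + (k * expo 6 1 x)))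

Θ-cong : ∀ B k {g h} → (∀ i → g i ≡ h i) → ∀ i → Θ B k g i ≡ Θ B k h i
Θ-cong B k g≗h i = ∑-cong (box B) (λ x → g≗h _)

-- The exponents of the theta series are nonnegative, so a coefficient of the product depends only
-- on coefficients at the same or smaller indices.
Θ-cong-≤ : ∀ B k {g h} {b} → (∀ {i} → i ℤ.≤ b → g i ≡ h i) →
           ∀ {i} → i ℤ.≤ b → Θ B k g i ≡ Θ B k h i
Θ-cong-≤ B k g≗h i≤b = ∑-cong (box B) (λ x → g≗h (ℤ.i≤j⇒i-k≤j (+ (k * expo 6 1 x)) i≤b))

-- This is f(qᵏ)² = f(q²ᵏ) over 𝔽₂, already true for the truncated series: swapping the two
-- summation variables cancels everything off the diagonal.
Θ-Θ : ∀ B k g i → Θ B k (Θ B k g) i ≡ Θ B (k + k) g i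
Θ-Θ B k g i = trans
  (∑-diagonal (box B) (λ x y → g (i ℤ.- ke x ℤ.- ke y)) (λ x y → cong g (swap i (ke x) (ke y))))
  (∑-cong (box B) (λ x → cong g (trans (merge i (ke x))
    (cong (λ n → i ℤ.- + n) (sym (ℕ.*-distribʳ-+ (expo 6 1 x) k k))))))
  where
  ke : ℤ → ℤ
  ke x = + (k * expo 6 1 x)
  swap : ∀ i a b → i ℤ.- a ℤ.- b ≡ i ℤ.- b ℤ.- a
  swap = ℤ.solve-∀
  merge : ∀ i a → i ℤ.- a ℤ.- a ≡ i ℤ.- (a ℤ.+ a)
  merge = ℤ.solve-∀

C : ℤ → Parity
C = extendByZero c₂

negative-minus : ∀ m n → ∃[ l ] -[1+ m ] ℤ.- + n ≡ -[1+ l ]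
negative-minus m zero    = m , refl
negative-minus m (suc n) = suc (m + n) , refl

-- This is f · (1/f) = 1, valid up to index `B`, where the truncated f agrees with the full one.
Θ₁-C≡δ : ∀ B {i} → i ℤ.≤ + B → Θ B 1 C i ≡ δ i
Θ₁-C≡δ B { -[1+ n ] } _ = trans (∑-cong (box B) vanish) (∑-zero (box B))
  where
  vanish : ∀ x → C (-[1+ n ] ℤ.- + (1 * expo 6 1 x)) ≡ 0ℙ
  vanish x = cong C (proj₂ (negative-minus n (1 * expo 6 1 x)))
Θ₁-C≡δ B {+ N} (ℤ.+≤+ N≤B) = begin
  Θ B 1 C (+ N) ≡⟨ ∑-cong (box B) shift ⟩
  ∑ (box B) (λ x → ∑ (upTo (suc N)) (λ j → [ expo 6 1 x ≐ j ] ℙ.* c₂ (N ∸ j)))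
    ≡⟨ ∑-comm (box B) (upTo (suc N)) (λ x j → [ expo 6 1 x ≐ j ] ℙ.* c₂ (N ∸ j)) ⟩
  ∑ (upTo (suc N)) (λ j → ∑ (box B) (λ x → [ expo 6 1 x ≐ j ] ℙ.* c₂ (N ∸ j)))
    ≡⟨ ∑-cong-∈ (upTo (suc N)) coefficient ⟩
  ∑ (upTo (suc N)) (λ j → ψ₂ j ℙ.* c₂ (N ∸ j)) ≡⟨ ψ₂-convolution-c₂ N ⟩
  δ (+ N) ∎
  where
  shift : ∀ x → C (+ N ℤ.- + (1 * expo 6 1 x)) ≡
                ∑ (upTo (suc N)) (λ j → [ expo 6 1 x ≐ j ] ℙ.* c₂ (N ∸ j))
  shift x = begin
    C (+ N ℤ.- + (1 * expo 6 1 x)) ≡⟨ cong (λ e → C (+ N ℤ.- + e)) (ℕ.*-identityˡ (expo 6 1 x)) ⟩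
    C (+ N ℤ.- + expo 6 1 x) ≡⟨ cong C (ℤ.[+m]-[+n]≡m⊖n N (expo 6 1 x)) ⟩
    C (N ⊖ expo 6 1 x) ≡⟨ ∑-shift c₂ (expo 6 1 x) N ⟨
    ∑ (upTo (suc N)) (λ j → [ expo 6 1 x ≐ j ] ℙ.* c₂ (N ∸ j)) ∎
  coefficient : ∀ {j} → j ∈ upTo (suc N) →
                ∑ (box B) (λ x → [ expo 6 1 x ≐ j ] ℙ.* c₂ (N ∸ j)) ≡ ψ₂ j ℙ.* c₂ (N ∸ j)
  coefficient {j} j∈ = trans (∑-*ʳ (box B) (λ x → [ expo 6 1 x ≐ j ]) (c₂ (N ∸ j)))
    (cong (ℙ._* c₂ (N ∸ j)) (sym (ψ₂≡∑box (ℕ.≤-trans (ℕ.≤-pred (∈-upTo⁻ j∈)) N≤B))))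

-- Split f(q⁸) as f(q⁴)², then one f(q⁴) as f(q²)², then one f(q²) as f(q)²; the last f(q) cancels
-- against its inverse.
Θ₈-C : ∀ B {i} → i ℤ.≤ + B → Θ B 8 C i ≡ Θ B 4 (Θ B 2 (Θ B 1 δ)) i
Θ₈-C B {i} i≤B = begin
  Θ B 8 C i                          ≡⟨ Θ-Θ B 4 C i ⟨
  Θ B 4 (Θ B 4 C) i                  ≡⟨ Θ-cong B 4 (λ i → sym (Θ-Θ B 2 C i)) i ⟩
  Θ B 4 (Θ B 2 (Θ B 2 C)) i          ≡⟨ Θ-cong B 4 (Θ-cong B 2 (λ i → sym (Θ-Θ B 1 C i))) i ⟩
  Θ B 4 (Θ B 2 (Θ B 1 (Θ B 1 C))) i
    ≡⟨ Θ-cong-≤ B 4 (Θ-cong-≤ B 2 (Θ-cong-≤ B 1 (Θ₁-C≡δ B))) i≤B ⟩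
  Θ B 4 (Θ B 2 (Θ B 1 δ)) i          ∎

-- Since f has constant term 1, it can be cancelled: the coefficient of the product at L is g(L)
-- plus values of g at smaller indices, so strong induction on L applies.
Θ₁-injective : ∀ B {g h} → (∀ n → g -[1+ n ] ≡ h -[1+ n ]) →
               ∀ b → (∀ {L} → L ≤ b → Θ B 1 g (+ L) ≡ Θ B 1 h (+ L)) →
               ∀ L → L ≤ b → g (+ L) ≡ h (+ L)
Θ₁-injective B {g} {h} g≗h₋ b Θg≗Θh = <-rec _ step
  where
  -- The tail of `box B` after its first entry 0, the entry of exponent 0. That 0 does not recur
  -- follows from `box-unique`.
  nonzero : List ℤ
  nonzero = map +_ (applyUpTo suc B) ++ map -[1+_] (upTo (suc B))
  0<∣x∣ : ∀ {x} → x ∈ nonzero → 0 < ∣ x ∣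
  0<∣x∣ {+ zero}   x∈ = contradiction x∈ (Unique.Unique[x∷xs]⇒x∉xs (box-unique B))
  0<∣x∣ {+ suc n}  _  = s≤s z≤n
  0<∣x∣ { -[1+ n ] } _ = s≤s z≤n
  step : ∀ L → (∀ {K} → K < L → K ≤ b → g (+ K) ≡ h (+ K)) → L ≤ b → g (+ L) ≡ h (+ L)
  step L rec L≤b = ℙ.+-cancelʳ-≡ (∑ nonzero (shifted g)) _ _
    (trans head+tail (cong (h (+ L) ℙ.+_) (sym tails)))
    where
    shifted : (ℤ → Parity) → ℤ → Parity
    shifted k x = k (+ L ℤ.- + (1 * expo 6 1 x))
    below : ∀ e → 0 < e → g (+ L ℤ.- + e) ≡ h (+ L ℤ.- + e)
    below e 0<e with ℕ.≤-<-connex e L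
    ... | inj₁ e≤L = subst (λ i → g i ≡ h i)
      (sym (trans (ℤ.[+m]-[+n]≡m⊖n L e) (ℤ.⊖-≥ e≤L)))
      (rec (ℕ.∸-monoʳ-< 0<e e≤L) (ℕ.≤-trans (ℕ.m∸n≤m L e) L≤b))
    -- Exponents beyond `L` lead to negative indices, where agreement is assumed.
    ... | inj₂ L<e with e ∸ L in e∸L≡ | ℕ.m<n⇒0<n∸m L<e
    ... | suc d | _ = subst (λ i → g i ≡ h i)
      (sym (trans (ℤ.[+m]-[+n]≡m⊖n L e) (trans (ℤ.⊖-< L<e) (cong (λ n → ℤ.- + n) e∸L≡))))
      (g≗h₋ d)
    tails : ∑ nonzero (shifted g) ≡ ∑ nonzero (shifted h)
    tails = ∑-cong-∈ nonzero λ {x} x∈ → below (1 * expo 6 1 x)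
      (subst (0 <_) (sym (ℕ.*-identityˡ (expo 6 1 x))) (ℕ.≤-trans (0<∣x∣ x∈) (∣x∣≤expo 6 1 x)))
    head+tail : g (+ L) ℙ.+ ∑ nonzero (shifted g) ≡ h (+ L) ℙ.+ ∑ nonzero (shifted h)
    head+tail = subst (λ i → g i ℙ.+ ∑ nonzero (shifted g) ≡ h i ℙ.+ ∑ nonzero (shifted h))
      (ℤ.+-identityʳ (+ L)) (Θg≗Θh L≤b)

-- The ternary quadratic forms

-- Odd integers are written as -(2k + 1) to match the components of `Φ`.
evenℤ⊎oddℤ : ∀ i → (∃[ k ] i ≡ + 2 ℤ.* k) ⊎ (∃[ k ] i ≡ ℤ.- (+ 2 ℤ.* k ℤ.+ + 1))
evenℤ⊎oddℤ (+ n) with even⊎odd n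
... | inj₁ (k , refl) = inj₁ (+ k , ℤ.pos-* 2 k)
... | inj₂ (k , refl) =
  inj₂ (ℤ.- + k ℤ.- + 1 , trans (cong (ℤ._+ + 1) (ℤ.pos-* 2 k)) (expand (+ k)))
  where
  expand : ∀ k → + 2 ℤ.* k ℤ.+ + 1 ≡ ℤ.- (+ 2 ℤ.* (ℤ.- k ℤ.- + 1) ℤ.+ + 1)
  expand = ℤ.solve-∀
evenℤ⊎oddℤ -[1+ n ] with even⊎odd n
... | inj₁ (k , refl) =
  inj₂ (+ k , cong ℤ.-_ (trans (ℤ.+-comm (+ 1) (+ (2 * k))) (cong (ℤ._+ + 1) (ℤ.pos-* 2 k))))
... | inj₂ (k , refl) = inj₁ (ℤ.- (+ k ℤ.+ + 1) ,
  trans (cong (λ i → ℤ.- (+ 1 ℤ.+ (i ℤ.+ + 1))) (ℤ.pos-* 2 k)) (expand (+ k)))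
  where
  expand : ∀ k → ℤ.- (+ 1 ℤ.+ (+ 2 ℤ.* k ℤ.+ + 1)) ≡ + 2 ℤ.* ℤ.- (k ℤ.+ + 1)
  expand = ℤ.solve-∀

ℤ³ : Set
ℤ³ = ℤ × ℤ × ℤ

-- The subtractions are ordered as in the unfolding of `Θ B 4 (Θ B 2 (Θ B 1 δ))`, so a zero is one
-- contribution to the coefficient of q^N. `χ` likewise follows `Θ B 1 (representations B)`.
φ : ℕ → ℤ³ → ℤ
φ N (x , y , z) =
  + N ℤ.- + (4 * expo 6 1 x) ℤ.- + (2 * expo 6 1 y) ℤ.- + (1 * expo 6 1 z)

χ : ℕ → ℤ³ → ℤ
χ L (u , v , w) =
  + L ℤ.- + (1 * expo 6 1 u) ℤ.- + expo 2 5 v ℤ.- + expo 4 3 w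

poly : ℤ → ℤ → ℤ
poly a x = x ℤ.* (+ 7 ℤ.* x ℤ.+ a)

*expo≡*poly : ∀ k x → + (k * expo 6 1 x) ≡ + k ℤ.* poly (+ 6) x
*expo≡*poly k x = trans (ℤ.pos-* k (expo 6 1 x)) (cong (+ k ℤ.*_) (expo≡poly 6 1 x))

φ-poly χ-poly : ℤ → ℤ³ → ℤ
φ-poly L (x , y , z) =
  + 8 ℤ.* L ℤ.+ + 7 ℤ.- + 4 ℤ.* poly (+ 6) x ℤ.- + 2 ℤ.* poly (+ 6) y ℤ.- + 1 ℤ.* poly (+ 6) z
χ-poly L (u , v , w) = L ℤ.- + 1 ℤ.* poly (+ 6) u ℤ.- poly (+ 2) v ℤ.- poly (+ 4) w

φ≡φ-poly : ∀ L s → φ (8 * L + 7) s ≡ φ-poly (+ L) s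
φ≡φ-poly L (x , y , z) = cong₂ ℤ._-_ (cong₂ ℤ._-_ (cong₂ ℤ._-_
  (cong (ℤ._+ + 7) (ℤ.pos-* 8 L)) (*expo≡*poly 4 x)) (*expo≡*poly 2 y)) (*expo≡*poly 1 z)

χ≡χ-poly : ∀ L t → χ L t ≡ χ-poly (+ L) t
χ≡χ-poly L (u , v , w) = cong₂ ℤ._-_ (cong₂ ℤ._-_ (cong (ℤ._-_ (+ L))
  (*expo≡*poly 1 u)) (expo≡poly 2 5 v)) (expo≡poly 4 3 w)

-- In terms of X = 7x + 3 etc. this is X = -(U + V), Y = -2W, Z = 2(V - U) with
-- U = 7u + 3, V = 7v + 1, W = 7w + 2, whence 4X² + 2Y² + Z² = 8(U² + V² + W²).
Φ : ℤ³ → ℤ³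
Φ (u , v , w) =
  ℤ.- (u ℤ.+ v ℤ.+ + 1) , ℤ.- (+ 2 ℤ.* w ℤ.+ + 1) , ℤ.- (+ 2 ℤ.* (u ℤ.- v) ℤ.+ + 1)

φ∘Φ : ∀ L t → φ (8 * L + 7) (Φ t) ≡ + 8 ℤ.* χ L t
φ∘Φ L t@(u , v , w) = trans (φ≡φ-poly L (Φ t))
  (trans (identity (+ L) u v w) (cong (λ i → + 8 ℤ.* i) (sym (χ≡χ-poly L t))))
  where
  identity : ∀ L u v w →
    + 8 ℤ.* L ℤ.+ + 7
      ℤ.- + 4 ℤ.* (ℤ.- (u ℤ.+ v ℤ.+ + 1) ℤ.* (+ 7 ℤ.* ℤ.- (u ℤ.+ v ℤ.+ + 1) ℤ.+ + 6))
      ℤ.- + 2 ℤ.* (ℤ.- (+ 2 ℤ.* w ℤ.+ + 1) ℤ.* (+ 7 ℤ.* ℤ.- (+ 2 ℤ.* w ℤ.+ + 1) ℤ.+ + 6))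
      ℤ.- + 1 ℤ.* (ℤ.- (+ 2 ℤ.* (u ℤ.- v) ℤ.+ + 1)
                    ℤ.* (+ 7 ℤ.* ℤ.- (+ 2 ℤ.* (u ℤ.- v) ℤ.+ + 1) ℤ.+ + 6))
    ≡ + 8 ℤ.* (L ℤ.- + 1 ℤ.* (u ℤ.* (+ 7 ℤ.* u ℤ.+ + 6))
        ℤ.- v ℤ.* (+ 7 ℤ.* v ℤ.+ + 2) ℤ.- w ℤ.* (+ 7 ℤ.* w ℤ.+ + 4))
  identity = ℤ.solve-∀

double-injective : ∀ {i j} → + 2 ℤ.* i ≡ + 2 ℤ.* j → i ≡ j
double-injective {i} {j} = ℤ.*-cancelˡ-≡ (+ 2) i j

-- The first and third components determine u + v and u - v, hence 2u and 2v.
Φ-injective : ∀ {s t} → Φ s ≡ Φ t → s ≡ t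
Φ-injective {u , v , w} {u′ , v′ , w′} eq = cong₂ _,_
  (double-injective (trans (2u u v) (trans (cong₂ ℤ._-_ (cong d-1 d≡) s≡) (sym (2u u′ v′)))))
  (cong₂ _,_
    (double-injective (trans (2v u v) (trans (cong₂ ℤ._-_ (cong -d-1 d≡) s≡) (sym (2v u′ v′)))))
    w≡)
  where
  odd-injective : ∀ {i j} → ℤ.- (+ 2 ℤ.* i ℤ.+ + 1) ≡ ℤ.- (+ 2 ℤ.* j ℤ.+ + 1) → i ≡ j
  odd-injective {i} {j} = double-injective ∘ ∙-cancelʳ (+ 1) _ _ ∘ ℤ.neg-injective
  d-1 -d-1 : ℤ → ℤ
  d-1 d = d ℤ.- + 1
  -d-1 d = ℤ.- d ℤ.- + 1
  s≡ : ℤ.- (u ℤ.+ v ℤ.+ + 1) ≡ ℤ.- (u′ ℤ.+ v′ ℤ.+ + 1)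
  s≡ = cong proj₁ eq
  d≡ : u ℤ.- v ≡ u′ ℤ.- v′
  d≡ = odd-injective (cong (proj₂ ∘ proj₂) eq)
  w≡ : w ≡ w′
  w≡ = odd-injective (cong (proj₁ ∘ proj₂) eq)
  2u : ∀ u v → + 2 ℤ.* u ≡ u ℤ.- v ℤ.- + 1 ℤ.- ℤ.- (u ℤ.+ v ℤ.+ + 1)
  2u = ℤ.solve-∀
  2v : ∀ u v → + 2 ℤ.* v ≡ ℤ.- (u ℤ.- v) ℤ.- + 1 ℤ.- ℤ.- (u ℤ.+ v ℤ.+ + 1)
  2v = ℤ.solve-∀

-- Modulo 2, 4 and 8 in turn, a zero of φ has z, then y, then x + t odd, where z = -(2t + 1).
Φ-onto-zeros : ∀ L s → φ (8 * L + 7) s ≡ + 0 → ∃[ t ] s ≡ Φ t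
Φ-onto-zeros L (x , y , z) φ≡0 = z-odd (evenℤ⊎oddℤ z)
  (trans (sym (φ≡φ-poly L (x , y , z))) φ≡0)
  where
  Even Odd : ℤ → Set
  Even i = ∃[ k ] i ≡ + 2 ℤ.* k
  Odd i  = ∃[ k ] i ≡ ℤ.- (+ 2 ℤ.* k ℤ.+ + 1)
  -- Half of `φ` at z = -(2t + 1), because `poly (+ 6)` takes the value 4 t(7t + 4) + 1 there. In
  -- the same way `quarter` is half of `half` at y = -(2w + 1).
  half : ℤ → ℤ → ℤ
  half y t =
    + 4 ℤ.* + L ℤ.+ + 3 ℤ.- + 2 ℤ.* poly (+ 6) x ℤ.- poly (+ 6) y ℤ.- + 2 ℤ.* poly (+ 4) t
  quarter : ℤ → ℤ → ℤ → ℤ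
  quarter x w t =
    + 2 ℤ.* + L ℤ.+ + 1 ℤ.- poly (+ 6) x ℤ.- + 2 ℤ.* poly (+ 4) w ℤ.- poly (+ 4) t

  -- Modulo 2, `quarter` is 1 + x + t, so it cannot vanish when x + t is even.
  x+t-odd : ∀ w t → Even (x ℤ.+ t) ⊎ Odd (x ℤ.+ t) → quarter x w t ≡ + 0 →
            ∃[ s ] (x , ℤ.- (+ 2 ℤ.* w ℤ.+ + 1) , ℤ.- (+ 2 ℤ.* t ℤ.+ + 1)) ≡ Φ s
  x+t-odd w t (inj₁ (k , x+t≡)) eq = contradiction
    (trans (sym (even (+ L) k w t)) (subst (λ x → quarter x w t ≡ + 0)
      (trans (shift x t) (cong (ℤ._- t) x+t≡)) eq))
    (2i+1≢0 (+ L ℤ.- poly (+ 4) w ℤ.- + 2 ℤ.* poly (+ 3) k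
      ℤ.+ t ℤ.* (+ 14 ℤ.* k ℤ.- + 7 ℤ.* t ℤ.+ + 1)))
    where
    shift : ∀ x t → x ≡ x ℤ.+ t ℤ.- t
    shift = ℤ.solve-∀
    even : ∀ L k w t →
      + 2 ℤ.* L ℤ.+ + 1 ℤ.- (+ 2 ℤ.* k ℤ.- t) ℤ.* (+ 7 ℤ.* (+ 2 ℤ.* k ℤ.- t) ℤ.+ + 6)
        ℤ.- + 2 ℤ.* (w ℤ.* (+ 7 ℤ.* w ℤ.+ + 4)) ℤ.- t ℤ.* (+ 7 ℤ.* t ℤ.+ + 4)
      ≡ + 2 ℤ.* (L ℤ.- w ℤ.* (+ 7 ℤ.* w ℤ.+ + 4) ℤ.- + 2 ℤ.* (k ℤ.* (+ 7 ℤ.* k ℤ.+ + 3))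
          ℤ.+ t ℤ.* (+ 14 ℤ.* k ℤ.- + 7 ℤ.* t ℤ.+ + 1)) ℤ.+ + 1
    even = ℤ.solve-∀
  -- The witness solves u - v = t and u + v + 1 = -x.
  x+t-odd w t (inj₂ (v , x+t≡)) _ = (t ℤ.+ v , v , w) , cong₂ _,_
    (trans (shift x t) (trans (cong (ℤ._- t) x+t≡) (regroup t v)))
    (cong (λ d → ℤ.- (+ 2 ℤ.* w ℤ.+ + 1) , ℤ.- (+ 2 ℤ.* d ℤ.+ + 1)) (shift t v))
    where
    shift : ∀ x t → x ≡ x ℤ.+ t ℤ.- t
    shift = ℤ.solve-∀
    regroup : ∀ t v → ℤ.- (+ 2 ℤ.* v ℤ.+ + 1) ℤ.- t ≡ ℤ.- (t ℤ.+ v ℤ.+ v ℤ.+ + 1)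
    regroup = ℤ.solve-∀

  y-odd : ∀ t → Even y ⊎ Odd y → half y t ≡ + 0 →
          ∃[ s ] (x , y , ℤ.- (+ 2 ℤ.* t ℤ.+ + 1)) ≡ Φ s
  y-odd t (inj₁ (k , refl)) eq = contradiction (trans (sym (even (+ L) x k t)) eq)
    (2i+1≢0 (+ 2 ℤ.* + L ℤ.+ + 1 ℤ.- poly (+ 6) x ℤ.- + 2 ℤ.* poly (+ 3) k ℤ.- poly (+ 4) t))
    where
    even : ∀ L x k t →
      + 4 ℤ.* L ℤ.+ + 3 ℤ.- + 2 ℤ.* (x ℤ.* (+ 7 ℤ.* x ℤ.+ + 6))
        ℤ.- + 2 ℤ.* k ℤ.* (+ 7 ℤ.* (+ 2 ℤ.* k) ℤ.+ + 6) ℤ.- + 2 ℤ.* (t ℤ.* (+ 7 ℤ.* t ℤ.+ + 4))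
      ≡ + 2 ℤ.* (+ 2 ℤ.* L ℤ.+ + 1 ℤ.- x ℤ.* (+ 7 ℤ.* x ℤ.+ + 6)
          ℤ.- + 2 ℤ.* (k ℤ.* (+ 7 ℤ.* k ℤ.+ + 3)) ℤ.- t ℤ.* (+ 7 ℤ.* t ℤ.+ + 4)) ℤ.+ + 1
    even = ℤ.solve-∀
  y-odd t (inj₂ (w , refl)) eq = x+t-odd w t (evenℤ⊎oddℤ (x ℤ.+ t))
    (double-injective (trans (double (+ L) x w t) eq))
    where
    double : ∀ L x w t →
      + 2 ℤ.* (+ 2 ℤ.* L ℤ.+ + 1 ℤ.- x ℤ.* (+ 7 ℤ.* x ℤ.+ + 6)
        ℤ.- + 2 ℤ.* (w ℤ.* (+ 7 ℤ.* w ℤ.+ + 4)) ℤ.- t ℤ.* (+ 7 ℤ.* t ℤ.+ + 4))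
      ≡ + 4 ℤ.* L ℤ.+ + 3 ℤ.- + 2 ℤ.* (x ℤ.* (+ 7 ℤ.* x ℤ.+ + 6))
          ℤ.- ℤ.- (+ 2 ℤ.* w ℤ.+ + 1) ℤ.* (+ 7 ℤ.* ℤ.- (+ 2 ℤ.* w ℤ.+ + 1) ℤ.+ + 6)
          ℤ.- + 2 ℤ.* (t ℤ.* (+ 7 ℤ.* t ℤ.+ + 4))
    double = ℤ.solve-∀

  z-odd : Even z ⊎ Odd z → φ-poly (+ L) (x , y , z) ≡ + 0 → ∃[ s ] (x , y , z) ≡ Φ s
  z-odd (inj₁ (k , refl)) eq = contradiction (trans (sym (even (+ L) x y k)) eq)
    (2i+1≢0 (+ 4 ℤ.* + L ℤ.+ + 3 ℤ.- + 2 ℤ.* poly (+ 6) x ℤ.- poly (+ 6) y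
      ℤ.- + 2 ℤ.* poly (+ 3) k))
    where
    even : ∀ L x y k →
      + 8 ℤ.* L ℤ.+ + 7 ℤ.- + 4 ℤ.* (x ℤ.* (+ 7 ℤ.* x ℤ.+ + 6))
        ℤ.- + 2 ℤ.* (y ℤ.* (+ 7 ℤ.* y ℤ.+ + 6))
        ℤ.- + 1 ℤ.* (+ 2 ℤ.* k ℤ.* (+ 7 ℤ.* (+ 2 ℤ.* k) ℤ.+ + 6))
      ≡ + 2 ℤ.* (+ 4 ℤ.* L ℤ.+ + 3 ℤ.- + 2 ℤ.* (x ℤ.* (+ 7 ℤ.* x ℤ.+ + 6))
          ℤ.- y ℤ.* (+ 7 ℤ.* y ℤ.+ + 6) ℤ.- + 2 ℤ.* (k ℤ.* (+ 7 ℤ.* k ℤ.+ + 3))) ℤ.+ + 1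
    even = ℤ.solve-∀
  z-odd (inj₂ (t , refl)) eq =
    y-odd t (evenℤ⊎oddℤ y) (double-injective (trans (double (+ L) x y t) eq))
    where
    double : ∀ L x y t →
      + 2 ℤ.* (+ 4 ℤ.* L ℤ.+ + 3 ℤ.- + 2 ℤ.* (x ℤ.* (+ 7 ℤ.* x ℤ.+ + 6))
        ℤ.- y ℤ.* (+ 7 ℤ.* y ℤ.+ + 6) ℤ.- + 2 ℤ.* (t ℤ.* (+ 7 ℤ.* t ℤ.+ + 4)))
      ≡ + 8 ℤ.* L ℤ.+ + 7 ℤ.- + 4 ℤ.* (x ℤ.* (+ 7 ℤ.* x ℤ.+ + 6))
          ℤ.- + 2 ℤ.* (y ℤ.* (+ 7 ℤ.* y ℤ.+ + 6))
          ℤ.- + 1 ℤ.* (ℤ.- (+ 2 ℤ.* t ℤ.+ + 1) ℤ.* (+ 7 ℤ.* ℤ.- (+ 2 ℤ.* t ℤ.+ + 1) ℤ.+ + 6))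
    double = ℤ.solve-∀

-- Matching the zeros of the two forms inside a finite cube

cube : ℕ → List ℤ³
cube B = cartesianProduct (box B) (cartesianProduct (box B) (box B))

cube-unique : ∀ B → Unique (cube B)
cube-unique B =
  Unique.cartesianProduct⁺ (box-unique B) (Unique.cartesianProduct⁺ (box-unique B) (box-unique B))

∑-cube : ∀ B f → ∑ (cube B) f ≡ ∑ (box B) λ x → ∑ (box B) λ y → ∑ (box B) λ z → f (x , y , z)
∑-cube B f = trans (∑-cartesianProduct (box B) (cartesianProduct (box B) (box B)) f)
  (∑-cong (box B) (λ x → ∑-cartesianProduct (box B) (box B) (λ yz → f (x , yz))))

sum-of-parts : ∀ n a b c → + n ℤ.- + a ℤ.- + b ℤ.- + c ≡ + 0 → n ≡ a + b + c
sum-of-parts n a b c eq =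
  ℤ.+-injective (ℤ.i-j≡0⇒i≡j (+ n) (+ (a + b + c)) (trans (regroup (+ n) (+ a) (+ b) (+ c)) eq))
  where
  regroup : ∀ n a b c → n ℤ.- (a ℤ.+ b ℤ.+ c) ≡ n ℤ.- a ℤ.- b ℤ.- c
  regroup = ℤ.solve-∀

-- At a zero the three exponents add up to `n`, so each is at most `B`, and each coordinate is
-- bounded by its exponent.
zeros-in-cube : ∀ {B n a b c} x y z → n ≤ B → + n ℤ.- + a ℤ.- + b ℤ.- + c ≡ + 0 →
                ∣ x ∣ ≤ a → ∣ y ∣ ≤ b → ∣ z ∣ ≤ c → (x , y , z) ∈ cube B
zeros-in-cube {n = n} {a} {b} {c} x y z n≤B eq x≤a y≤b z≤c with sum-of-parts n a b c eq
... | refl = ∈-cartesianProduct⁺ (∈-box x (≤B x≤a (ℕ.≤-trans (ℕ.m≤m+n a b) (ℕ.m≤m+n (a + b) c))))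
  (∈-cartesianProduct⁺ (∈-box y (≤B y≤b (ℕ.≤-trans (ℕ.m≤n+m b a) (ℕ.m≤m+n (a + b) c))))
    (∈-box z (≤B z≤c (ℕ.m≤n+m c (a + b)))))
  where
  ≤B : ∀ {i j} → i ≤ j → j ≤ a + b + c → i ≤ _
  ≤B i≤j j≤ = ℕ.≤-trans i≤j (ℕ.≤-trans j≤ n≤B)

-- `Φ` is a bijection between the zeros of `χ` and those of `φ`. It does not preserve the cube, but
-- all zeros on either side lie in it.
∑-φ≡∑-χ : ∀ B L → 8 * L + 7 ≤ B → ∑ (cube B) (δ ∘ φ (8 * L + 7)) ≡ ∑ (cube B) (δ ∘ χ L)
∑-φ≡∑-χ B L N≤B = ∑-reindex Φ (δ ∘ φ (8 * L + 7)) (δ ∘ χ L) (cube-unique B) (cube-unique B)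
  Φ-injective δφΦ≡δχ onto into
  where
  δφΦ≡δχ : ∀ t → δ (φ (8 * L + 7) (Φ t)) ≡ δ (χ L t)
  δφΦ≡δχ t = trans (cong δ (φ∘Φ L t)) (δ-8* (χ L t))
  L≤B : L ≤ B
  L≤B = ℕ.≤-trans (ℕ.≤-trans (ℕ.m≤n*m L 8) (ℕ.m≤m+n (8 * L) 7)) N≤B
  bound : ∀ k .{{_ : NonZero k}} x → ∣ x ∣ ≤ k * expo 6 1 x
  bound k x = ℕ.≤-trans (∣x∣≤expo 6 1 x) (ℕ.m≤n*m _ k)
  χ-zero∈cube : ∀ t → χ L t ≡ + 0 → t ∈ cube B
  χ-zero∈cube (u , v , w) eq =
    zeros-in-cube u v w L≤B eq (bound 1 u) (∣x∣≤expo 2 5 v) (∣x∣≤expo 4 3 w)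
  φ-zero∈cube : ∀ s → φ (8 * L + 7) s ≡ + 0 → s ∈ cube B
  φ-zero∈cube (x , y , z) eq = zeros-in-cube x y z N≤B eq (bound 4 x) (bound 2 y) (bound 1 z)
  onto : ∀ {s} → s ∈ cube B → δ (φ (8 * L + 7) s) ≡ 1ℙ → ∃[ t ] t ∈ cube B × s ≡ Φ t
  onto {s} _ φ≡0 with Φ-onto-zeros L s (δ≡1⇒≡0 _ φ≡0)
  ... | t , refl = t , χ-zero∈cube t (δ≡1⇒≡0 _ (trans (sym (δφΦ≡δχ t)) φ≡0)) , refl
  into : ∀ {t} → t ∈ cube B → δ (χ L t) ≡ 1ℙ → Φ t ∈ cube B
  into {t} _ χ≡0 = φ-zero∈cube (Φ t)
    (trans (φ∘Φ L t) (cong (λ i → + 8 ℤ.* i) (δ≡1⇒≡0 _ χ≡0)))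

-- The section 8L + 7

-- For i at most B, the parity of the number of solutions of V² + W² = 7i + 5 with V = 7v + 1 and W
-- = 7w + 2.
representations : ℕ → ℤ → Parity
representations B i = ∑ (box B) λ v → ∑ (box B) λ w → δ (i ℤ.- + expo 2 5 v ℤ.- + expo 4 3 w)

section : ℤ → Parity
section i = C (+ 8 ℤ.* i ℤ.+ + 7)

-- Multiplication by f(q⁸) moves indices by multiples of 8, so on the coefficients at 8L + 7 it acts
-- as multiplication by f(q).
Θ₁-section≡Θ₁-representations : ∀ B L → 8 * L + 7 ≤ B →
                                Θ B 1 section (+ L) ≡ Θ B 1 (representations B) (+ L)
Θ₁-section≡Θ₁-representations B L N≤B = begin
  Θ B 1 section (+ L)                      ≡⟨ ∑-cong (box B) (λ x → cong C (dilate x)) ⟨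
  Θ B 8 C (+ (8 * L + 7))                  ≡⟨ Θ₈-C B (ℤ.+≤+ N≤B) ⟩
  Θ B 4 (Θ B 2 (Θ B 1 δ)) (+ (8 * L + 7))  ≡⟨ ∑-cube B (δ ∘ φ (8 * L + 7)) ⟨
  ∑ (cube B) (δ ∘ φ (8 * L + 7))           ≡⟨ ∑-φ≡∑-χ B L N≤B ⟩
  ∑ (cube B) (δ ∘ χ L)                     ≡⟨ ∑-cube B (δ ∘ χ L) ⟩
  Θ B 1 (representations B) (+ L)          ∎
  where
  dilate : ∀ x → + (8 * L + 7) ℤ.- + (8 * expo 6 1 x) ≡
                 + 8 ℤ.* (+ L ℤ.- + (1 * expo 6 1 x)) ℤ.+ + 7
  dilate x = begin
    + (8 * L + 7) ℤ.- + (8 * expo 6 1 x)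
      ≡⟨ cong₂ ℤ._-_ (cong (ℤ._+ + 7) (ℤ.pos-* 8 L)) (ℤ.pos-* 8 (expo 6 1 x)) ⟩
    + 8 ℤ.* + L ℤ.+ + 7 ℤ.- + 8 ℤ.* + expo 6 1 x ≡⟨ factor (+ L) (+ expo 6 1 x) ⟩
    + 8 ℤ.* (+ L ℤ.- + expo 6 1 x) ℤ.+ + 7
      ≡⟨ cong (λ e → + 8 ℤ.* (+ L ℤ.- + e) ℤ.+ + 7) (ℕ.*-identityˡ (expo 6 1 x)) ⟨
    + 8 ℤ.* (+ L ℤ.- + (1 * expo 6 1 x)) ℤ.+ + 7 ∎
    where
    factor : ∀ L e → + 8 ℤ.* L ℤ.+ + 7 ℤ.- + 8 ℤ.* e ≡ + 8 ℤ.* (L ℤ.- e) ℤ.+ + 7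
    factor = ℤ.solve-∀

representations-negative : ∀ B n → representations B -[1+ n ] ≡ 0ℙ
representations-negative B n = trans (∑-cong (box B) λ v →
  trans (∑-cong (box B) (λ w → vanish (expo 2 5 v) (expo 4 3 w))) (∑-zero (box B))) (∑-zero (box B))
  where
  vanish : ∀ a b → δ (-[1+ n ] ℤ.- + a ℤ.- + b) ≡ 0ℙ
  vanish a b with negative-minus n a
  ... | m , eq = trans (cong (λ i → δ (i ℤ.- + b)) eq) (cong δ (proj₂ (negative-minus m b)))

-- The offset 7 is less than 8, so a negative index stays negative: 8(-(n + 1)) + 7 = -(8n + 1).
section-negative : ∀ n → section -[1+ n ] ≡ 0ℙ
section-negative n = cong C (begin
  + 8 ℤ.* -[1+ n ] ℤ.+ + 7            ≡⟨ cong (ℤ._+ + 7) (ℤ.neg-distribʳ-* (+ 8) (+ suc n)) ⟨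
  ℤ.- (+ 8 ℤ.* + suc n) ℤ.+ + 7       ≡⟨ cong (λ i → ℤ.- i ℤ.+ + 7) (ℤ.pos-* 8 (suc n)) ⟨
  ℤ.- + (8 * suc n) ℤ.+ + 7           ≡⟨ cong (λ m → ℤ.- + m ℤ.+ + 7) (expand n) ⟩
  ℤ.- + (7 + suc (8 * n)) ℤ.+ + 7     ≡⟨ cancel (+ (8 * n)) ⟩
  -[1+ 8 * n ]                        ∎)
  where
  expand : ∀ n → 8 * suc n ≡ 7 + suc (8 * n)
  expand = ℕ.solve-∀
  cancel : ∀ m → ℤ.- (+ 7 ℤ.+ (+ 1 ℤ.+ m)) ℤ.+ + 7 ≡ ℤ.- (+ 1 ℤ.+ m)
  cancel = ℤ.solve-∀

-- Cancel f(q) on both sides. One box, chosen for `L`, serves all smaller indices in the induction.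
c₂-section : ∀ L → c₂ (8 * L + 7) ≡ representations (8 * L + 7) (+ L)
c₂-section L = trans (cong C (cong (ℤ._+ + 7) (ℤ.pos-* 8 L)))
  (Θ₁-injective B {section} {representations B}
    (λ n → trans (section-negative n) (sym (representations-negative B n))) L
    (λ {K} K≤L → Θ₁-section≡Θ₁-representations B K (ℕ.+-monoˡ-≤ 7 (ℕ.*-monoʳ-≤ 8 K≤L))) L ℕ.≤-refl)
  where
  B = 8 * L + 7

∣i∣*∣i∣ : ∀ i → + (∣ i ∣ * ∣ i ∣) ≡ i ℤ.* i
∣i∣*∣i∣ (+ n)    = ℤ.pos-* n n
∣i∣*∣i∣ -[1+ n ] = refl

-- Multiplication by 7 completes the squares: 7v(7v + 2) = (7v + 1)² - 1 and 7w(7w + 4) = (7w + 2)²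
-- - 4.
representation⇒sum-of-squares : ∀ L v w → + L ℤ.- + expo 2 5 v ℤ.- + expo 4 3 w ≡ + 0 →
  ∃[ x ] ∃[ y ] x * x + y * y ≡ 7 * L + 5
representation⇒sum-of-squares L v w eq = ∣ X ∣ , ∣ Y ∣ , ℤ.+-injective (begin
  + (∣ X ∣ * ∣ X ∣) ℤ.+ + (∣ Y ∣ * ∣ Y ∣) ≡⟨ cong₂ ℤ._+_ (∣i∣*∣i∣ X) (∣i∣*∣i∣ Y) ⟩
  X ℤ.* X ℤ.+ Y ℤ.* Y ≡⟨ complete-squares (+ L) v w ⟩
  + 7 ℤ.* + L ℤ.+ + 5 ℤ.- + 7 ℤ.* (+ L ℤ.- poly (+ 2) v ℤ.- poly (+ 4) w)
    ≡⟨ cong₂ (λ a b → + 7 ℤ.* + L ℤ.+ + 5 ℤ.- + 7 ℤ.* (+ L ℤ.- a ℤ.- b))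
         (expo≡poly 2 5 v) (expo≡poly 4 3 w) ⟨
  + 7 ℤ.* + L ℤ.+ + 5 ℤ.- + 7 ℤ.* (+ L ℤ.- + expo 2 5 v ℤ.- + expo 4 3 w)
    ≡⟨ cong (λ i → + 7 ℤ.* + L ℤ.+ + 5 ℤ.- + 7 ℤ.* i) eq ⟩
  + 7 ℤ.* + L ℤ.+ + 5 ℤ.+ + 0 ≡⟨ ℤ.+-identityʳ _ ⟩
  + 7 ℤ.* + L ℤ.+ + 5 ≡⟨ cong (ℤ._+ + 5) (ℤ.pos-* 7 L) ⟨
  + (7 * L + 5) ∎)
  where
  X = + 7 ℤ.* v ℤ.+ + 1
  Y = + 7 ℤ.* w ℤ.+ + 2
  complete-squares : ∀ L v w →
    (+ 7 ℤ.* v ℤ.+ + 1) ℤ.* (+ 7 ℤ.* v ℤ.+ + 1) ℤ.+ (+ 7 ℤ.* w ℤ.+ + 2) ℤ.* (+ 7 ℤ.* w ℤ.+ + 2)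
    ≡ + 7 ℤ.* L ℤ.+ + 5
        ℤ.- + 7 ℤ.* (L ℤ.- v ℤ.* (+ 7 ℤ.* v ℤ.+ + 2) ℤ.- w ℤ.* (+ 7 ℤ.* w ℤ.+ + 4))
  complete-squares = ℤ.solve-∀

c₂-vanishes : ∀ L → (∀ x y → x * x + y * y ≢ 7 * L + 5) → c₂ (8 * L + 7) ≡ 0ℙ
c₂-vanishes L no-rep = trans (c₂-section L) (trans (∑-cong (box B) λ v →
  trans (∑-cong (box B) (vanish v)) (∑-zero (box B))) (∑-zero (box B)))
  where
  B = 8 * L + 7
  vanish : ∀ v w → δ (+ L ℤ.- + expo 2 5 v ℤ.- + expo 4 3 w) ≡ 0ℙ
  vanish v w with δ (+ L ℤ.- + expo 2 5 v ℤ.- + expo 4 3 w) in eq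
  ... | 0ℙ = refl
  ... | 1ℙ with representation⇒sum-of-squares L v w (δ≡1⇒≡0 _ eq)
  ... | x , y , x²+y²≡ = contradiction x²+y²≡ (no-rep x y)

-- Residues of p and the arithmetic progression

parity≡0⇒2∣ : ∀ n → ℕ.parity n ≡ 0ℙ → 2 ∣ n
parity≡0⇒2∣ zero          _  = 2 ℕ.∣0
parity≡0⇒2∣ (suc (suc n)) eq = ℕ.∣m∣n⇒∣m+n ℕ.∣-refl (parity≡0⇒2∣ n eq)

*-%7≡1 : ∀ m n → m % 7 ≡ 1 → n % 7 ≡ 1 → (m * n) % 7 ≡ 1
*-%7≡1 m n m≡1 n≡1 = trans (ℕ.%-distribˡ-* m n 7) (cong₂ (λ a b → (a * b) % 7) m≡1 n≡1)

^-%7≡1 : ∀ m k → m % 7 ≡ 1 → (m ^ k) % 7 ≡ 1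
^-%7≡1 m zero    _   = refl
^-%7≡1 m (suc k) m≡1 = *-%7≡1 m (m ^ k) m≡1 (^-%7≡1 m k m≡1)

prime∣^⇒∣ : ∀ {p} → Prime p → ∀ a k → p ∣ a ^ k → p ∣ a
prime∣^⇒∣ p-prime a zero    p∣1 = ℕ.∣-trans p∣1 (ℕ.1∣ a)
prime∣^⇒∣ p-prime a (suc k) p∣ with euclidsLemma a (a ^ k) p-prime p∣
... | inj₁ p∣a  = p∣a
... | inj₂ p∣aᵏ = prime∣^⇒∣ p-prime a k p∣aᵏ

residue-28⇒4 : ∀ p → p % 28 ≡ 15 ⊎ p % 28 ≡ 27 → p % 4 ≡ 3
residue-28⇒4 p h = trans (sym (ℕ.m∣n⇒o%n%m≡o%m 4 28 p (divides 7 refl))) (reduce h)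
  where
  reduce : ∀ {r} → r ≡ 15 ⊎ r ≡ 27 → r % 4 ≡ 3
  reduce (inj₁ refl) = refl
  reduce (inj₂ refl) = refl

-- Here p is 1 or -1 modulo 7; this makes the division by 7 in the index exact.
residue-28⇒p²%7 : ∀ p → p % 28 ≡ 15 ⊎ p % 28 ≡ 27 → (p * p) % 7 ≡ 1
residue-28⇒p²%7 p h = trans (ℕ.%-distribˡ-* p p 7)
  (trans (cong (λ r → (r * r) % 7) (sym (ℕ.m∣n⇒o%n%m≡o%m 7 28 p (divides 4 refl)))) (reduce h))
  where
  reduce : ∀ {r} → r ≡ 15 ⊎ r ≡ 27 → (r % 7 * (r % 7)) % 7 ≡ 1
  reduce (inj₁ refl) = refl
  reduce (inj₂ refl) = refl

-- The residue forces p ≥ 15; this excludes the primes 2 and 7 together.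
residue-28⇒∤14 : ∀ p → p % 28 ≡ 15 ⊎ p % 28 ≡ 27 → ¬ p ∣ 14
residue-28⇒∤14 p h p∣14 = ℕ.<⇒≱ (15≤ h) (ℕ.≤-trans (ℕ.m%n≤m p 28) (ℕ.∣⇒≤ p∣14))
  where
  15≤ : ∀ {r} → r ≡ 15 ⊎ r ≡ 27 → 15 ≤ r
  15≤ (inj₁ refl) = ℕ.≤-refl
  15≤ (inj₂ refl) = ℕ.m≤m+n 15 12

-- Otherwise p would divide 8ᵏ(7n + 5p), hence 2, 7 or n.
no-sum-of-squares : ∀ {p} → Prime p → p % 4 ≡ 3 → ¬ p ∣ 2 → ¬ p ∣ 7 → ∀ {n} → ¬ p ∣ n →
  ∀ k m x y → x * x + y * y ≢ p ^ (2 * m + 1) * (8 ^ k * (7 * n + 5 * p))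
no-sum-of-squares {p} p-prime p%4≡3 p∤2 p∤7 {n} p∤n k m x y eq
  with euclidsLemma (8 ^ k) (7 * n + 5 * p) p-prime
         (sum-of-squares-odd-power p-prime p%4≡3 m _ x y eq)
... | inj₁ p∣8ᵏ = p∤2 (prime∣^⇒∣ p-prime 2 3 (prime∣^⇒∣ p-prime 8 k p∣8ᵏ))
... | inj₂ p∣7n+5p with euclidsLemma 7 n p-prime
  (ℕ.∣m+n∣m⇒∣n (subst (p ∣_) (ℕ.+-comm (7 * n) (5 * p)) p∣7n+5p) (ℕ.n∣m*n 5))
... | inj₁ p∣7 = p∤7 p∣7
... | inj₂ p∣n = p∤n p∣n

2^[3k+3] : ∀ k → 2 ^ (3 * k + 3) ≡ 8 * 8 ^ k
2^[3k+3] k = trans (ℕ.^-distribˡ-+-* 2 (3 * k) 3)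
  (trans (cong (_* 8) (sym (ℕ.^-*-assoc 2 3 k))) (ℕ.*-comm (8 ^ k) 8))

p^[2m+2] : ∀ p m → p ^ (2 * m + 2) ≡ (p * p) ^ suc m
p^[2m+2] p m = trans (cong (p ^_) (trans (ℕ.+-comm (2 * m) 2) (sym (ℕ.*-suc 2 m))))
  (trans (sym (ℕ.^-*-assoc p 2 (suc m))) (cong (λ q → (p * q) ^ suc m) (ℕ.*-identityʳ p)))

theorem4p2 : (p : ℕ) → Prime p → (p % 28 ≡ 15 ⊎ p % 28 ≡ 27) →
    (m n k : ℕ) → ¬ (p ∣ n) →
    + 2 ∣ℤ c 13 1 (2 ^ (3 * k + 3) * p ^ (2 * m + 1) * n
    + (5 * 2 ^ (3 * k + 3) * p ^ (2 * m + 2) + 9) / 7)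
theorem4p2 p p-prime p%28 m n k p∤n = parity≡0⇒2∣ _ (trans (cong c₂ index) (c₂-vanishes L no-rep))
  where
  E P Q w L : ℕ
  E = 8 ^ k
  P = p ^ (2 * m + 1)
  Q = p ^ (2 * m + 2)
  -- As E Q = 1 + 7w, the numerator 40 E Q + 9 is 7(40w + 7), and the quotient 40w + 7 yields the
  -- index 8L + 7.
  w = E * Q / 7
  L = E * P * n + 5 * w
  EQ%7≡1 : (E * Q) % 7 ≡ 1
  EQ%7≡1 = *-%7≡1 E Q (^-%7≡1 8 k refl)
    (trans (cong (_% 7) (p^[2m+2] p m)) (^-%7≡1 (p * p) (suc m) (residue-28⇒p²%7 p p%28)))
  EQ≡1+7w : E * Q ≡ 1 + w * 7
  EQ≡1+7w = trans (ℕ.m≡m%n+[m/n]*n (E * Q) 7) (cong (_+ w * 7) EQ%7≡1)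
  numerator : 5 * (8 * E) * Q + 9 ≡ (40 * w + 7) * 7
  numerator = trans (assoc E Q) (trans (cong (λ z → 40 * z + 9) EQ≡1+7w) (expand w))
    where
    assoc : ∀ E Q → 5 * (8 * E) * Q + 9 ≡ 40 * (E * Q) + 9
    assoc = ℕ.solve-∀
    expand : ∀ w → 40 * (1 + w * 7) + 9 ≡ (40 * w + 7) * 7
    expand = ℕ.solve-∀
  index : 2 ^ (3 * k + 3) * P * n + (5 * 2 ^ (3 * k + 3) * Q + 9) / 7 ≡ 8 * L + 7
  index = begin
    2 ^ (3 * k + 3) * P * n + (5 * 2 ^ (3 * k + 3) * Q + 9) / 7
      ≡⟨ cong (λ e → e * P * n + (5 * e * Q + 9) / 7) (2^[3k+3] k) ⟩
    8 * E * P * n + (5 * (8 * E) * Q + 9) / 7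
      ≡⟨ cong (λ q → 8 * E * P * n + q) (trans (cong (_/ 7) numerator)
           (ℕ.m*n/n≡m (40 * w + 7) 7)) ⟩
    8 * E * P * n + (40 * w + 7)
      ≡⟨ regroup E P n w ⟩
    8 * L + 7 ∎
    where
    regroup : ∀ E P n w → 8 * E * P * n + (40 * w + 7) ≡ 8 * (E * P * n + 5 * w) + 7
    regroup = ℕ.solve-∀
  -- Substituting 1 + 7w = E Q and Q = p P exhibits the odd power P of p as a factor.
  7L+5 : 7 * L + 5 ≡ P * (E * (7 * n + 5 * p))
  7L+5 = begin
    7 * L + 5 ≡⟨ regroup E P n w ⟩
    7 * (E * P * n) + 5 * (1 + w * 7) ≡⟨ cong (λ z → 7 * (E * P * n) + 5 * z) EQ≡1+7w ⟨
    7 * (E * P * n) + 5 * (E * Q)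
      ≡⟨ cong (λ q → 7 * (E * P * n) + 5 * (E * q)) (cong (p ^_) (ℕ.+-suc (2 * m) 1)) ⟩
    7 * (E * P * n) + 5 * (E * (p * P)) ≡⟨ factor E P n p ⟩
    P * (E * (7 * n + 5 * p)) ∎
    where
    regroup : ∀ E P n w → 7 * (E * P * n + 5 * w) + 5 ≡ 7 * (E * P * n) + 5 * (1 + w * 7)
    regroup = ℕ.solve-∀
    factor : ∀ E P n p → 7 * (E * P * n) + 5 * (E * (p * P)) ≡ P * (E * (7 * n + 5 * p))
    factor = ℕ.solve-∀
  no-rep : ∀ x y → x * x + y * y ≢ 7 * L + 5
  no-rep x y eq = no-sum-of-squares p-prime (residue-28⇒4 p p%28)
    (λ p∣2 → residue-28⇒∤14 p p%28 (ℕ.∣-trans p∣2 (divides 7 refl)))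
    (λ p∣7 → residue-28⇒∤14 p p%28 (ℕ.∣-trans p∣7 (divides 2 refl)))
    p∤n k m x y (trans eq 7L+5)
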